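{- For every integer $d\ge 1$, every $d$-dimensional real inner-product space $V$, every full-rank lattice $\mathcal L\subset V$, every $\boldsymbol\alpha\in V$, and every integer $N\ge 2$, $$ g_N(\boldsymbol\alpha,\mathcal L)\le 2^d+1. $$
   Context: Let $V$ be a $d$-dimensional real inner-product space with induced norm $\|\cdot\|$, $\mathcal L\subset V$ a full-rank lattice (a discrete subgroup spanning $V$), and $\boldsymbol\alpha\in V$. For integers $N\ge 2$ and $1\le n\le N$, set $$\delta_{n,N}=\min\{\|(m-n)\boldsymbol\alpha+\ell\| : m\in\mathbb Z,\ 1\le m\le N,\ \ell\in\mathcal L,\ (m-n)\boldsymbol\alpha+\ell\neq 0\}.$$ (The choice $m=n$ is allowed, in which case $\ell$ is a nonzero lattice vector.) Define $g_N(\boldsymbol\alpha,\mathcal L)=\#\{\delta_{n,N}:1\le n\le N\}$, the number of distinct values among $\delta_{1,N},\dots,\delta_{N,N}$. -}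

module Defs where

open import Level using (Level; _⊔_; suc; Lift; lift)
open import Algebra.Bundles using (CommutativeRing)
open import Algebra.Module.Bundles using (LeftModule)
open import Data.Fin.Base using (Fin)
open import Data.Integer.Base as ℤ using (ℤ; +_; -[1+_])
open import Data.List.Base using (List; map; upTo; length; deduplicate)
open import Data.Nat.Base as ℕ using (ℕ)
open import Data.Product.Base using (Σ; ∃; _×_; _,_; proj₁; proj₂)
open import Data.Sum.Base using (inj₁; inj₂)
open import Relation.Binary.Bundles using (DecTotalOrder)
open import Relation.Binary.Core using (Rel)
open import Relation.Binary.Structures using (IsDecTotalOrder)
open import Relation.Nullary.Decidable.Core using (yes; no)
open import Relation.Unary using (Pred; _∈_)
import Algebra.Definitions.RawMonoid
import Algebra.Solver.Ring.NaturalCoefficients.Default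
import Relation.Binary.Properties.DecTotalOrder
import Relation.Binary.Reasoning.PartialOrder

-- The library has no real numbers.  ℝ is characterised, uniquely up to
-- isomorphism, as a Dedekind-complete totally ordered field.  As for the
-- classical reals, equality and order are decidable (trichotomy).

record CompleteOrderedField (c ℓ : Level) : Set (suc (c ⊔ ℓ)) where
  infix 4 _≤_
  field
    commutativeRing : CommutativeRing c ℓ

  open CommutativeRing commutativeRing public
    hiding (isEquivalence; isPartialEquivalence)
    renaming (refl to ≈-refl; sym to ≈-sym; trans to ≈-trans; reflexive to ≈-reflexive)

  field
    _≤_             : Rel Carrier ℓ
    isDecTotalOrder : IsDecTotalOrder _≈_ _≤_
    0≉1             : 0# ≉ 1#
    inverse         : ∀ x → x ≉ 0# → ∃ λ y → x * y ≈ 1#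
    +-monoˡ-≤       : ∀ z {x y} → x ≤ y → x + z ≤ y + z
    *-nonneg        : ∀ {x y} → 0# ≤ x → 0# ≤ y → 0# ≤ x * y

  UpperBound : Pred Carrier (c ⊔ ℓ) → Carrier → Set (c ⊔ ℓ)
  UpperBound P u = ∀ x → x ∈ P → x ≤ u

  field
    supremum : ∀ (P : Pred Carrier (c ⊔ ℓ)) → ∃ P → ∃ (UpperBound P) →
               ∃ λ s → UpperBound P s × (∀ u → UpperBound P u → s ≤ u)

  decTotalOrder : DecTotalOrder c ℓ ℓ
  decTotalOrder = record { isDecTotalOrder = isDecTotalOrder }

  open DecTotalOrder decTotalOrder public
    using (_≟_; _≤?_; total; antisym; poset; totalOrder; ≤-respˡ-≈; ≤-respʳ-≈)
    renaming (refl to ≤-refl; trans to ≤-trans; reflexive to ≤-reflexive)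
  open Relation.Binary.Properties.DecTotalOrder decTotalOrder public
    using (_<_)

module _ {c ℓ : Level} (ℝ : CompleteOrderedField c ℓ) where
  open CompleteOrderedField ℝ

  IsMinimum : ∀ {p} → Pred Carrier p → Carrier → Set (c ⊔ ℓ ⊔ p)
  IsMinimum P r = r ∈ P × (∀ s → s ∈ P → r ≤ s)

  #values : (ℕ → Carrier) → ℕ → ℕ
  #values f N = length (deduplicate _≟_ (map (λ i → f (ℕ.suc i)) (upTo N)))

module SquareRoot {c ℓ : Level} (ℝ : CompleteOrderedField c ℓ) where
  open CompleteOrderedField ℝ
  open Relation.Binary.Reasoning.PartialOrder poset
  open Algebra.Solver.Ring.NaturalCoefficients.Default commutativeSemiring
    using (solve; _:=_; _:+_; _:*_)

  private
    +-monoʳ-≤ : ∀ z {x y} → x ≤ y → z + x ≤ z + y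
    +-monoʳ-≤ z {x} {y} x≤y = begin
      z + x ≈⟨ +-comm z x ⟩
      x + z ≤⟨ +-monoˡ-≤ z x≤y ⟩
      y + z ≈⟨ +-comm y z ⟩
      z + y ∎

    diff : ∀ x y → x + (y + - x) ≈ y
    diff x y = begin-equality
      x + (y + - x) ≈⟨ +-comm x (y + - x) ⟩
      (y + - x) + x ≈⟨ +-assoc y (- x) x ⟩
      y + (- x + x) ≈⟨ +-congˡ (-‿inverseˡ x) ⟩
      y + 0#        ≈⟨ +-identityʳ y ⟩
      y             ∎

    0≤diff : ∀ {x y} → x ≤ y → 0# ≤ y + - x
    0≤diff {x} {y} x≤y = begin
      0#      ≈⟨ -‿inverseʳ x ⟨
      x + - x ≤⟨ +-monoˡ-≤ (- x) x≤y ⟩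
      y + - x ∎

    x≤x+e : ∀ x {e} → 0# ≤ e → x ≤ x + e
    x≤x+e x {e} 0≤e = begin
      x      ≈⟨ +-identityʳ x ⟨
      x + 0# ≤⟨ +-monoʳ-≤ x 0≤e ⟩
      x + e  ∎

    +-cancel-≤ : ∀ x {y z} → x + y ≤ x + z → y ≤ z
    +-cancel-≤ x {y} {z} le = begin
      y               ≈⟨ lem y ⟩
      (x + y) + - x   ≤⟨ +-monoˡ-≤ (- x) le ⟩
      (x + z) + - x   ≈⟨ lem z ⟨
      z               ∎
      where
      lem : ∀ w → w ≈ (x + w) + - x
      lem w = begin-equality
        w               ≈⟨ +-identityʳ w ⟨
        w + 0#          ≈⟨ +-congˡ (-‿inverseʳ x) ⟨
        w + (x + - x)   ≈⟨ +-assoc w x (- x) ⟨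
        (w + x) + - x   ≈⟨ +-congʳ (+-comm w x) ⟩
        (x + w) + - x   ∎

    e≤0⇒e≈0 : ∀ x {e} → 0# ≤ e → x + e ≤ x → e ≈ 0#
    e≤0⇒e≈0 x {e} 0≤e le =
      antisym (+-cancel-≤ x (≤-trans le (≤-reflexive (≈-sym (+-identityʳ x))))) 0≤e

    +-nonneg : ∀ {x y} → 0# ≤ x → 0# ≤ y → 0# ≤ x + y
    +-nonneg {x} 0≤x 0≤y = ≤-trans 0≤x (x≤x+e x 0≤y)

    *-monoʳ-≤ : ∀ {z} → 0# ≤ z → ∀ {x y} → x ≤ y → z * x ≤ z * y
    *-monoʳ-≤ {z} 0≤z {x} {y} x≤y = begin
      z * x                   ≤⟨ x≤x+e (z * x) (*-nonneg 0≤z (0≤diff x≤y)) ⟩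
      z * x + z * (y + - x)   ≈⟨ distribˡ z x (y + - x) ⟨
      z * (x + (y + - x))     ≈⟨ *-congˡ (diff x y) ⟩
      z * y                   ∎

    *-monoˡ-≤ : ∀ {z} → 0# ≤ z → ∀ {x y} → x ≤ y → x * z ≤ y * z
    *-monoˡ-≤ {z} 0≤z {x} {y} x≤y = begin
      x * z ≈⟨ *-comm x z ⟩
      z * x ≤⟨ *-monoʳ-≤ 0≤z x≤y ⟩
      z * y ≈⟨ *-comm z y ⟩
      y * z ∎

    sq-nonneg : ∀ x → 0# ≤ x * x
    sq-nonneg x with total 0# x
    ... | inj₁ 0≤x = *-nonneg 0≤x 0≤x
    ... | inj₂ x≤0 = begin
      0#              ≤⟨ *-nonneg 0≤y 0≤y ⟩
      y * y           ≈⟨ +-identityˡ (y * y) ⟨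
      0# + y * y      ≈⟨ +-congʳ (zeroʳ x) ⟨
      x * 0# + y * y  ≈⟨ +-congʳ (*-congˡ (diff x 0#)) ⟨
      x * (x + y) + y * y
        ≈⟨ solve 2 (λ a b → (a :* (a :+ b) :+ b :* b) := (a :* a :+ (a :+ b) :* b)) ≈-refl x y ⟩
      x * x + (x + y) * y  ≈⟨ +-congˡ (*-congʳ (diff x 0#)) ⟩
      x * x + 0# * y       ≈⟨ +-congˡ (zeroˡ y) ⟩
      x * x + 0#           ≈⟨ +-identityʳ (x * x) ⟩
      x * x                ∎
      where
      y : Carrier
      y = 0# + - x
      0≤y : 0# ≤ y
      0≤y = 0≤diff x≤0

    0≤1 : 0# ≤ 1#
    0≤1 = ≤-trans (sq-nonneg 1#) (≤-reflexive (*-identityʳ 1#))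

    inv-nonneg : ∀ {x i} → 0# ≤ x → x * i ≈ 1# → 0# ≤ i
    inv-nonneg {x} {i} 0≤x xi≈1 = begin
      0#           ≤⟨ *-nonneg 0≤x (sq-nonneg i) ⟩
      x * (i * i)  ≈⟨ *-assoc x i i ⟨
      (x * i) * i  ≈⟨ *-congʳ xi≈1 ⟩
      1# * i       ≈⟨ *-identityˡ i ⟩
      i            ∎

    sq≈0⇒≈0 : ∀ x → x * x ≈ 0# → x ≈ 0#
    sq≈0⇒≈0 x xx≈0 with x ≟ 0#
    ... | yes x≈0 = x≈0
    ... | no  x≉0 with inverse x x≉0
    ...   | i , xi≈1 = begin-equality
      x            ≈⟨ *-identityʳ x ⟨
      x * 1#       ≈⟨ *-congˡ xi≈1 ⟨
      x * (x * i)  ≈⟨ *-assoc x x i ⟨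
      (x * x) * i  ≈⟨ *-congʳ xx≈0 ⟩
      0# * i       ≈⟨ zeroˡ i ⟩
      0#           ∎

    sq-cancel-≤ : ∀ {x y} → 0# ≤ y → x * x ≤ y * y → x ≤ y
    sq-cancel-≤ {x} {y} 0≤y xx≤yy with total x y
    ... | inj₁ x≤y = x≤y
    ... | inj₂ y≤x = ≤-reflexive (begin-equality
      x       ≈⟨ diff y x ⟨
      y + e   ≈⟨ +-congˡ (sq≈0⇒≈0 e ee≈0) ⟩
      y + 0#  ≈⟨ +-identityʳ y ⟩
      y       ∎)
      where
      e : Carrier
      e = x + - y
      0≤e : 0# ≤ e
      0≤e = 0≤diff y≤x
      ee≈0 : e * e ≈ 0#
      ee≈0 = e≤0⇒e≈0 (y * y) (sq-nonneg e) (begin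
        y * y + e * e  ≤⟨ x≤x+e _ (*-nonneg 0≤y (+-nonneg 0≤e 0≤e)) ⟩
        (y * y + e * e) + y * (e + e)
          ≈⟨ solve 2 (λ a b → (a :* a :+ b :* b :+ a :* (b :+ b)) := ((a :+ b) :* (a :+ b))) ≈-refl y e ⟩
        (y + e) * (y + e)  ≈⟨ *-cong (diff y x) (diff y x) ⟩
        x * x          ≤⟨ xx≤yy ⟩
        y * y          ∎)

    div-cancel : ∀ e D i → D * i ≈ 1# → (e * i) * D ≈ e
    div-cancel e D i Di≈1 = begin-equality
      (e * i) * D  ≈⟨ *-assoc e i D ⟩
      e * (i * D)  ≈⟨ *-congˡ (*-comm i D) ⟩
      e * (D * i)  ≈⟨ *-congˡ Di≈1 ⟩
      e * 1#       ≈⟨ *-identityʳ e ⟩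
      e            ∎

    module Root (a : Carrier) (0≤a : 0# ≤ a) where

      S : Pred Carrier (c ⊔ ℓ)
      S x = Lift c (0# ≤ x × x * x ≤ a)

      bounded : UpperBound S (1# + a)
      bounded x (lift (_ , xx≤a)) = sq-cancel-≤ (+-nonneg 0≤1 0≤a) (begin
        x * x                ≤⟨ xx≤a ⟩
        a                    ≤⟨ x≤x+e a (+-nonneg (sq-nonneg 1#) (*-nonneg 0≤a (+-nonneg 0≤1 0≤a))) ⟩
        a + (1# * 1# + a * (1# + a))
          ≈⟨ +-congʳ (*-identityˡ a) ⟨
        1# * a + (1# * 1# + a * (1# + a))
          ≈⟨ solve 2 (λ u v → (u :* v :+ (u :* u :+ v :* (u :+ v))) := ((u :+ v) :* (u :+ v))) ≈-refl 1# a ⟩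
        (1# + a) * (1# + a)  ∎)

      sup : ∃ λ s → UpperBound S s × (∀ u → UpperBound S u → s ≤ u)
      sup = supremum S
        (0# , lift (≤-refl , ≤-trans (≤-reflexive (zeroˡ 0#)) 0≤a))
        (1# + a , bounded)

      s : Carrier
      s = proj₁ sup

      s-upper : UpperBound S s
      s-upper = proj₁ (proj₂ sup)

      s-least : ∀ u → UpperBound S u → s ≤ u
      s-least = proj₂ (proj₂ sup)

      0≤s : 0# ≤ s
      0≤s = s-upper 0# (lift (≤-refl , ≤-trans (≤-reflexive (zeroˡ 0#)) 0≤a))

      too-small : ∀ e → 0# ≤ e → s * s + e ≈ a → e ≈ 0#
      too-small e 0≤e ss+e≈a = begin-equality
        e      ≈⟨ εD≈e ⟨
        ε * D  ≈⟨ *-congʳ ε≈0 ⟩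
        0# * D ≈⟨ zeroˡ D ⟩
        0#     ∎
        where
        D : Carrier
        D = (s + s + 1#) + e
        0≤D′ : 0# ≤ s + s + 1#
        0≤D′ = +-nonneg (+-nonneg 0≤s 0≤s) 0≤1
        0≤D : 0# ≤ D
        0≤D = +-nonneg 0≤D′ 0≤e
        D≉0 : D ≉ 0#
        D≉0 D≈0 = 0≉1 (antisym 0≤1 (begin
          1#                      ≤⟨ x≤x+e 1# (+-nonneg (+-nonneg 0≤s 0≤s) 0≤e) ⟩
          1# + (s + s + e)
            ≈⟨ solve 3 (λ u v w → (u :+ (v :+ v :+ w)) := (v :+ v :+ u :+ w)) ≈-refl 1# s e ⟩
          D                       ≈⟨ D≈0 ⟩
          0#                      ∎))
        i : Carrier
        i = proj₁ (inverse D D≉0)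
        Di≈1 : D * i ≈ 1#
        Di≈1 = proj₂ (inverse D D≉0)
        0≤i : 0# ≤ i
        0≤i = inv-nonneg 0≤D Di≈1
        ε : Carrier
        ε = e * i
        0≤ε : 0# ≤ ε
        0≤ε = *-nonneg 0≤e 0≤i
        εD≈e : ε * D ≈ e
        εD≈e = div-cancel e D i Di≈1
        ε≤1 : ε ≤ 1#
        ε≤1 = begin
          e * i                   ≤⟨ *-monoˡ-≤ 0≤i (x≤x+e e 0≤D′) ⟩
          (e + (s + s + 1#)) * i  ≈⟨ *-congʳ (+-comm e (s + s + 1#)) ⟩
          D * i                   ≈⟨ Di≈1 ⟩
          1#                      ∎
        ε≈0 : ε ≈ 0#
        ε≈0 = e≤0⇒e≈0 s 0≤ε (s-upper (s + ε) (lift (+-nonneg 0≤s 0≤ε , (begin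
          (s + ε) * (s + ε)
            ≈⟨ solve 2 (λ u v → ((u :+ v) :* (u :+ v)) := (u :* u :+ v :* (u :+ u :+ v))) ≈-refl s ε ⟩
          s * s + ε * (s + s + ε)   ≤⟨ +-monoʳ-≤ (s * s) (*-monoʳ-≤ 0≤ε (+-monoʳ-≤ (s + s) ε≤1)) ⟩
          s * s + ε * (s + s + 1#)  ≤⟨ +-monoʳ-≤ (s * s) (*-monoʳ-≤ 0≤ε (x≤x+e (s + s + 1#) 0≤e)) ⟩
          s * s + ε * D             ≈⟨ +-congˡ εD≈e ⟩
          s * s + e                 ≈⟨ ss+e≈a ⟩
          a                         ∎))))

      too-large : ∀ e → 0# ≤ e → a + e ≈ s * s → e ≈ 0#
      too-large e 0≤e a+e≈ss with (s + s) ≟ 0#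
      ... | yes 2s≈0 = antisym (begin
        e      ≤⟨ x≤x+e e 0≤a ⟩
        e + a  ≈⟨ +-comm e a ⟩
        a + e  ≈⟨ a+e≈ss ⟩
        s * s  ≈⟨ *-congʳ (antisym (≤-trans (x≤x+e s 0≤s) (≤-reflexive 2s≈0)) 0≤s) ⟩
        0# * s ≈⟨ zeroˡ s ⟩
        0#     ∎) 0≤e
      ... | no 2s≉0 = begin-equality
        e            ≈⟨ ε2s≈e ⟨
        ε * (s + s)  ≈⟨ *-congʳ ε≈0 ⟩
        0# * (s + s) ≈⟨ zeroˡ (s + s) ⟩
        0#           ∎
        where
        i : Carrier
        i = proj₁ (inverse (s + s) 2s≉0)
        2si≈1 : (s + s) * i ≈ 1#
        2si≈1 = proj₂ (inverse (s + s) 2s≉0)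
        0≤i : 0# ≤ i
        0≤i = inv-nonneg (+-nonneg 0≤s 0≤s) 2si≈1
        ε t : Carrier
        ε = e * i
        t = s + - ε
        0≤ε : 0# ≤ ε
        0≤ε = *-nonneg 0≤e 0≤i
        ε2s≈e : ε * (s + s) ≈ e
        ε2s≈e = div-cancel e (s + s) i 2si≈1
        ε+t≈s : ε + t ≈ s
        ε+t≈s = diff ε s
        0≤t2s : 0# ≤ t * (s + s)
        0≤t2s = ≤-trans (+-nonneg (sq-nonneg s) 0≤a) (+-cancel-≤ e (begin
          e + (s * s + a)
            ≈⟨ solve 3 (λ u v w → (u :+ (v :* v :+ w)) := (v :* v :+ (w :+ u))) ≈-refl e s a ⟩
          s * s + (a + e)    ≈⟨ +-congˡ a+e≈ss ⟩
          s * s + s * s      ≈⟨ distribˡ s s s ⟨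
          s * (s + s)        ≈⟨ *-congʳ ε+t≈s ⟨
          (ε + t) * (s + s)  ≈⟨ distribʳ (s + s) ε t ⟩
          ε * (s + s) + t * (s + s)  ≈⟨ +-congʳ ε2s≈e ⟩
          e + t * (s + s)    ∎))
        0≤t : 0# ≤ t
        0≤t = begin
          0#                 ≤⟨ *-nonneg 0≤t2s 0≤i ⟩
          t * (s + s) * i    ≈⟨ *-assoc t (s + s) i ⟩
          t * ((s + s) * i)  ≈⟨ *-congˡ 2si≈1 ⟩
          t * 1#             ≈⟨ *-identityʳ t ⟩
          t                  ∎
        a≤tt : a ≤ t * t
        a≤tt = +-cancel-≤ e (begin
          e + a                  ≤⟨ x≤x+e (e + a) (sq-nonneg ε) ⟩
          (e + a) + ε * ε        ≈⟨ +-congʳ (+-comm e a) ⟩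
          (a + e) + ε * ε        ≈⟨ +-congʳ a+e≈ss ⟩
          s * s + ε * ε          ≈⟨ +-congʳ (*-cong ε+t≈s ε+t≈s) ⟨
          (ε + t) * (ε + t) + ε * ε
            ≈⟨ solve 2 (λ u v → ((u :+ v) :* (u :+ v) :+ u :* u) := (u :* ((u :+ v) :+ (u :+ v)) :+ v :* v)) ≈-refl ε t ⟩
          ε * ((ε + t) + (ε + t)) + t * t
            ≈⟨ +-congʳ (*-congˡ (+-cong ε+t≈s ε+t≈s)) ⟩
          ε * (s + s) + t * t    ≈⟨ +-congʳ ε2s≈e ⟩
          e + t * t              ∎)
        s≤t : s ≤ t
        s≤t = s-least t (λ x x∈S → sq-cancel-≤ 0≤t (≤-trans (proj₂ (Lift.lower x∈S)) a≤tt))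
        ε≈0 : ε ≈ 0#
        ε≈0 = e≤0⇒e≈0 t 0≤ε (begin
          t + ε  ≈⟨ +-comm t ε ⟩
          ε + t  ≈⟨ ε+t≈s ⟩
          s      ≤⟨ s≤t ⟩
          t      ∎)

      ss≈a : s * s ≈ a
      ss≈a with total (s * s) a
      ... | inj₁ ss≤a = begin-equality
        s * s         ≈⟨ +-identityʳ (s * s) ⟨
        s * s + 0#    ≈⟨ +-congˡ (too-small (a + - (s * s)) (0≤diff ss≤a) (diff (s * s) a)) ⟨
        s * s + (a + - (s * s))  ≈⟨ diff (s * s) a ⟩
        a             ∎
      ... | inj₂ a≤ss = begin-equality
        s * s         ≈⟨ diff a (s * s) ⟨
        a + (s * s + - a)
          ≈⟨ +-congˡ (too-large (s * s + - a) (0≤diff a≤ss) (diff a (s * s))) ⟩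
        a + 0#        ≈⟨ +-identityʳ a ⟩
        a             ∎

  abstract
    sqrt : ∀ a → 0# ≤ a → ∃ λ s → 0# ≤ s × s * s ≈ a
    sqrt a 0≤a = Root.s a 0≤a , Root.0≤s a 0≤a , Root.ss≈a a 0≤a

record InnerProductSpace {c ℓ : Level} (ℝ : CompleteOrderedField c ℓ)
                         (v ℓv : Level) : Set (c ⊔ ℓ ⊔ suc (v ⊔ ℓv)) where
  open CompleteOrderedField ℝ
  field
    leftModule : LeftModule ring v ℓv

  open LeftModule leftModule public

  field
    ⟨_,_⟩       : Carrierᴹ → Carrierᴹ → Carrier
    ⟨⟩-cong     : ∀ {x x′ y y′} → x ≈ᴹ x′ → y ≈ᴹ y′ → ⟨ x , y ⟩ ≈ ⟨ x′ , y′ ⟩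
    ⟨⟩-sym      : ∀ x y → ⟨ x , y ⟩ ≈ ⟨ y , x ⟩
    ⟨⟩-+        : ∀ x y z → ⟨ x +ᴹ y , z ⟩ ≈ ⟨ x , z ⟩ + ⟨ y , z ⟩
    ⟨⟩-*        : ∀ r x y → ⟨ r *ₗ x , y ⟩ ≈ r * ⟨ x , y ⟩
    ⟨⟩-nonneg   : ∀ x → 0# ≤ ⟨ x , x ⟩
    ⟨⟩-definite : ∀ x → ⟨ x , x ⟩ ≈ 0# → x ≈ᴹ 0ᴹ

  ‖_‖ : Carrierᴹ → Carrier
  ‖ x ‖ = proj₁ (SquareRoot.sqrt ℝ ⟨ x , x ⟩ (⟨⟩-nonneg x))

  infixl 6 _-ᴹ_
  _-ᴹ_ : Carrierᴹ → Carrierᴹ → Carrierᴹ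
  x -ᴹ y = x +ᴹ (-ᴹ y)

  open Algebra.Definitions.RawMonoid +ᴹ-rawMonoid public
    using () renaming (sum to sumᴹ; _×_ to _×ᴹ_)

  infixr 8 _·_
  _·_ : ℤ → Carrierᴹ → Carrierᴹ
  (+ n)    · x = n ×ᴹ x
  -[1+ n ] · x = -ᴹ (ℕ.suc n ×ᴹ x)

  linearCombination : ∀ {k} → (Fin k → Carrier) → (Fin k → Carrierᴹ) → Carrierᴹ
  linearCombination r x = sumᴹ (λ i → r i *ₗ x i)

  LinearlyIndependent : ∀ {k} → (Fin k → Carrierᴹ) → Set (c ⊔ ℓ ⊔ ℓv)
  LinearlyIndependent {k} x =
    ∀ (r : Fin k → Carrier) → linearCombination r x ≈ᴹ 0ᴹ → ∀ i → r i ≈ 0#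

  Spans : ∀ {p} → Pred Carrierᴹ p → Set (c ⊔ v ⊔ ℓv ⊔ p)
  Spans P = ∀ y → ∃ λ k → Σ (Fin k → Carrier) λ r → Σ (Fin k → Carrierᴹ) λ x →
            (∀ i → x i ∈ P) × y ≈ᴹ linearCombination r x

  HasDimension : ℕ → Set (c ⊔ ℓ ⊔ v ⊔ ℓv)
  HasDimension d = Σ (Fin d → Carrierᴹ) λ b →
    LinearlyIndependent b × (∀ y → ∃ λ r → y ≈ᴹ linearCombination r b)

  record IsFullRankLattice {p : Level} (L : Pred Carrierᴹ p) : Set (c ⊔ ℓ ⊔ v ⊔ ℓv ⊔ p) where
    field
      ∈-resp-≈ : ∀ {x y} → x ≈ᴹ y → x ∈ L → y ∈ L
      0∈       : 0ᴹ ∈ L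
      +∈       : ∀ {x y} → x ∈ L → y ∈ L → x +ᴹ y ∈ L
      -∈       : ∀ {x} → x ∈ L → -ᴹ x ∈ L
      discrete : ∀ x → x ∈ L →
                 ∃ λ ε → 0# < ε × (∀ y → y ∈ L → ‖ y -ᴹ x ‖ < ε → y ≈ᴹ x)
      spanning : Spans L

module _ {c ℓ v ℓv p : Level} {ℝ : CompleteOrderedField c ℓ}
         (V : InnerProductSpace ℝ v ℓv) where
  open CompleteOrderedField ℝ
  open InnerProductSpace V

  distances : (L : Pred Carrierᴹ p) (α : Carrierᴹ) (N n : ℕ) →
              Pred Carrier (ℓ ⊔ v ⊔ ℓv ⊔ p)
  distances L α N n r = ∃ λ (m : ℤ) → ∃ λ (l : Carrierᴹ) →
    (+ 1) ℤ.≤ m × m ℤ.≤ (+ N) × l ∈ L ×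
    ((m ℤ.- (+ n)) · α +ᴹ l ≉ᴹ 0ᴹ) × r ≈ ‖ (m ℤ.- (+ n)) · α +ᴹ l ‖

  -- The minimum over a lattice cannot be computed from the data in general, so
  -- δ is specified rather than defined; each δ n with 1 ≤ n ≤ N is determined
  -- up to ≈ because minima are unique.
  IsMinimalDistance : (L : Pred Carrierᴹ p) (α : Carrierᴹ) (N : ℕ) →
                      (ℕ → Carrier) → Set (c ⊔ ℓ ⊔ v ⊔ ℓv ⊔ p)
  IsMinimalDistance L α N δ =
    ∀ n → 1 ℕ.≤ n → n ℕ.≤ N → IsMinimum ℝ (distances L α N n) (δ n)

{-# OPTIONS --safe #-}
-- Let Λ be the lattice of all (k , k α + l) in ℤ × V with l ∈ L.  By the symmetry
-- (k , x) ↦ (− k , − x), δ n is the least norm of a nonzero x with (k , x) ∈ Λ and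
-- |k| ≤ max (n − 1) (N − n).  Hence, besides its largest value, δ takes one value for
-- each record: a point w = (a , x) of Λ with ⌊N/2⌋ < a < N such that x is shorter than
-- every nonzero y with (k , y) ∈ Λ and |k| < a.  Since the heights a of records are
-- within a factor 2 of each other, halves of suitable signed sums of records compete
-- with the records.  By the parallelogram law no two records are congruent modulo 2Λ,
-- and none lies in 2Λ.  If w₁ + w₂ + w₃ ∈ 2Λ for three records, then the halves t, u, v
-- of the three sums with one sign reversed lie in Λ, and
--   |t|² + |u|² + |v|² ≤ |u + v|² + |t + v|² + |t + u|² = |x₁|² + |x₂|² + |x₃|²
-- contradicts minimality.  So the records form a sum-free set in Λ/2Λ, and
-- |Λ/2Λ| ≤ 2 ^ (1 + d) leaves room for at most 2 ^ d of them.  For this last bound,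
-- n incongruent points of Λ yield n ^ t distinct points as base 2 expansions of length
-- t, which lie in a region of size O(2 ^ t), while Λ is discrete.
module Submission where

open import Defs
open import Algebra.Bundles using (AbelianGroup; RawMonoid)
import Algebra.Construct.DirectProduct
import Algebra.Definitions.RawMonoid
import Algebra.Properties.AbelianGroup
import Algebra.Properties.Monoid.Mult
import Algebra.Properties.Ring
import Algebra.Solver.CommutativeMonoid
import Algebra.Solver.Ring.NaturalCoefficients.Default
open import Data.Empty using (⊥; ⊥-elim)
open import Data.Fin as Fin using (Fin; zero; suc; combine; finToFun; fromℕ<; funToFin; join; splitAt)
import Data.Fin.Properties as Fin
open import Data.Integer as ℤ using (ℤ; +_)
import Data.Integer.Properties as ℤ
open import Data.Integer.Solver using () renaming (module +-*-Solver to ℤ-Solver)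
open import Data.List.Base using (List; []; _∷_; map; upTo; length; lookup; deduplicate)
open import Data.List.Membership.Propositional.Properties using (∈-lookup)
open import Data.List.Properties using (length-map)
open import Data.List.Relation.Unary.All as All using (All; []; _∷_)
import Data.List.Relation.Unary.All.Properties as All
open import Data.List.Relation.Unary.AllPairs using (AllPairs; []; _∷_)
open import Data.List.Relation.Unary.Any as Any using (Any; here; there)
open import Data.List.Relation.Unary.Any.Properties using (lookup-index)
import Data.List.Relation.Unary.Unique.DecSetoid.Properties
open import Data.Nat as ℕ using (ℕ; zero; suc)
import Data.Nat.Properties as ℕ
open import Data.Product using (∃; ∃₂; _×_; _,_; proj₁; proj₂)
open import Data.Sum using (inj₁; inj₂; [_,_]′)
open import Function using (_∘_; case_of_)
open import Level using (Level; _⊔_; Lift; lift)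
open import Relation.Binary using (tri<; tri≈; tri>)
open import Relation.Binary.Bundles using (DecTotalOrder)
open import Relation.Binary.PropositionalEquality as ≡ using (_≡_; _≢_; _≗_)
import Relation.Binary.Properties.DecTotalOrder
import Relation.Binary.Reasoning.PartialOrder
import Relation.Binary.Reasoning.Setoid
open import Relation.Nullary using (¬_; yes; no; contradiction)
open import Relation.Unary using (Pred; _∈_)

-- Counting: growth of powers and the pigeonhole principle.

module Counting where
  open import Data.Nat using (_+_; _*_; _^_; _≤_; _<_; NonZero; s≤s; z≤n)
  open import Data.Nat.Properties
  open import Data.Nat.Solver using (module +-*-Solver)

  -- Bernoulli's inequality `1 + t / P ≤ (1 + 1 / P) ^ t`, cleared of denominators.
  bernoulli : ∀ P t → P ^ t * (P + t) ≤ suc P ^ t * P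
  bernoulli P zero = ≤-reflexive (≡.cong (1 *_) (+-identityʳ P))
  bernoulli P (suc t) = begin
    P * P ^ t * (P + suc t)
      ≡⟨ solve 3 (λ p q t → p :* q :* (p :+ (con 1 :+ t)) := p :* (q :* (p :+ t)) :+ q :* p) ≡.refl P (P ^ t) t ⟩
    P * (P ^ t * (P + t)) + P ^ t * P
      ≤⟨ +-mono-≤ (*-monoʳ-≤ P (bernoulli P t)) (*-monoˡ-≤ P (^-monoˡ-≤ t (n≤1+n P))) ⟩
    P * (suc P ^ t * P) + suc P ^ t * P
      ≡⟨ solve 2 (λ p q → p :* (q :* p) :+ q :* p := (con 1 :+ p) :* q :* p) ≡.refl P (suc P ^ t) ⟩
    suc P * suc P ^ t * P ∎
    where
    open ≤-Reasoning
    open +-*-Solver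

  exponential-growth : ∀ P .{{_ : NonZero P}} H → ∃ λ t → P ^ t * H < suc P ^ t
  -- For `t = P * H` the factor `(P + t) / P` in `bernoulli` is `suc H`, strictly more than `H`.
  exponential-growth P H = P * H , <-≤-trans
    (*-monoʳ-< (P ^ (P * H)) {{m^n≢0 P (P * H)}} (n<1+n H))
    (*-cancelʳ-≤ (P ^ (P * H) * suc H) (suc P ^ (P * H)) P (begin
      P ^ (P * H) * suc H * P
        ≡⟨ solve 3 (λ q h p → q :* (con 1 :+ h) :* p := q :* (p :+ p :* h)) ≡.refl (P ^ (P * H)) H P ⟩
      P ^ (P * H) * (P + P * H)  ≤⟨ bernoulli P (P * H) ⟩
      suc P ^ (P * H) * P        ∎))
    where
    open ≤-Reasoning
    open +-*-Solver

  ^-distribʳ-* : ∀ m n o → (m * n) ^ o ≡ m ^ o * n ^ o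
  ^-distribʳ-* m n zero = ≡.refl
  ^-distribʳ-* m n (suc o) rewrite ^-distribʳ-* m n o =
    solve 4 (λ a b c d → a :* b :* (c :* d) := a :* c :* (b :* d)) ≡.refl m n (m ^ o) (n ^ o)
    where open +-*-Solver

  funToFin-cong : ∀ {m n} {f g : Fin m → Fin n} → f ≗ g → funToFin f ≡ funToFin g
  funToFin-cong {zero}  f≗g = ≡.refl
  funToFin-cong {suc m} f≗g = ≡.cong₂ combine (f≗g zero) (funToFin-cong (f≗g ∘ suc))

  -- The pigeonhole principle carried over to functions by coding them as elements of `Fin (n ^ l)`
  -- and `Fin (m ^ k)`. Pointwise equality `≗` stands for equality of functions.
  pigeonhole-→ : ∀ {k l m n} → m ^ k < n ^ l → (f : (Fin l → Fin n) → (Fin k → Fin m)) →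
                 ∃₂ λ s s′ → ¬ s ≗ s′ × f s ≗ f s′
  pigeonhole-→ {k} {l} {m} {n} lt f with Fin.pigeonhole lt (funToFin ∘ f ∘ finToFun)
  ... | i , j , i<j , eq = finToFun i , finToFun j , distinct , same
    where
    distinct : ¬ finToFun {n} {l} i ≗ finToFun j
    distinct ≗ = Fin.<⇒≢ i<j (≡.trans (≡.sym (Fin.funToFin-finToFin {l} i))
                         (≡.trans (funToFin-cong ≗) (Fin.funToFin-finToFin {l} j)))
    same : f (finToFun i) ≗ f (finToFun j)
    same e = ≡.trans (≡.sym (Fin.finToFun-funToFin (f (finToFun i)) e))
             (≡.trans (≡.cong (λ x → finToFun x e) eq) (Fin.finToFun-funToFin (f (finToFun j)) e))

  -- (2 ^ t ∸ 1) * C, the largest base 2 expansion with t digits at most C.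
  binaryBound : ℕ → ℕ → ℕ
  binaryBound C zero    = 0
  binaryBound C (suc t) = C + (binaryBound C t + binaryBound C t)

  -- The summand `suc C` on the left strengthens the claim so that the induction step merely doubles
  -- it.
  binaryBound-≤ : ∀ C t → suc C + binaryBound C t ≤ 2 ^ t * suc C
  binaryBound-≤ C zero = ≤-reflexive (≡.trans (+-identityʳ (suc C)) (≡.sym (*-identityˡ (suc C))))
  binaryBound-≤ C (suc t) = begin
    suc C + (C + (b + b))       ≤⟨ n≤1+n _ ⟩
    suc (suc C + (C + (b + b)))
      ≡⟨ solve 2 (λ c b → con 1 :+ (con 1 :+ c :+ (c :+ (b :+ b))) := con 2 :* (con 1 :+ c :+ b)) ≡.refl C b ⟩
    2 * (suc C + b)             ≤⟨ *-monoʳ-≤ 2 (binaryBound-≤ C t) ⟩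
    2 * (2 ^ t * suc C)         ≡⟨ *-assoc 2 (2 ^ t) (suc C) ⟨
    2 ^ suc t * suc C           ∎
    where
    b = binaryBound C t
    open ≤-Reasoning
    open +-*-Solver

  -- The left side is at most `(2 ^ t * E) ^ D`, which is `(2 ^ D) ^ t` times the constant `E ^ D`.
  -- Since `n` is at least `suc (2 ^ D)`, the power `n ^ t` overtakes it.
  few-cells : ∀ C D {n} → 2 ^ D < n → ∃ λ t → suc (binaryBound C t + binaryBound C t) ^ D < n ^ t
  few-cells C D {n} 2^D<n = go (exponential-growth (2 ^ D) {{m^n≢0 2 D}} ((suc C + suc C) ^ D))
    where
    open ≤-Reasoning
    open +-*-Solver
    E = suc C + suc C
    go : (∃ λ t → (2 ^ D) ^ t * E ^ D < suc (2 ^ D) ^ t) → _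
    go (t , lt) = t , (begin-strict
      suc (b + b) ^ D        ≤⟨ ^-monoˡ-≤ D (begin
        suc (b + b)          ≤⟨ s≤s (+-mono-≤ (m≤n+m b C) (m≤n+m b (suc C))) ⟩
        (suc C + b) + (suc C + b)   ≤⟨ +-mono-≤ (binaryBound-≤ C t) (binaryBound-≤ C t) ⟩
        2 ^ t * suc C + 2 ^ t * suc C ≡⟨ *-distribˡ-+ (2 ^ t) (suc C) (suc C) ⟨
        2 ^ t * E            ∎) ⟩
      (2 ^ t * E) ^ D        ≡⟨ ^-distribʳ-* (2 ^ t) E D ⟩
      (2 ^ t) ^ D * E ^ D    ≡⟨ ≡.cong (_* E ^ D) (≡.trans (^-*-assoc 2 t D) (≡.trans (≡.cong (2 ^_) (*-comm t D)) (≡.sym (^-*-assoc 2 D t)))) ⟩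
      (2 ^ D) ^ t * E ^ D    <⟨ lt ⟩
      suc (2 ^ D) ^ t        ≤⟨ ^-monoˡ-≤ t 2^D<n ⟩
      n ^ t                  ∎)
      where b = binaryBound C t

open Counting using (pigeonhole-→; binaryBound; few-cells)

-- Base 2 expansions and congruence modulo doubles in an abelian group.

module DigitSum {c ℓ : Level} (M : RawMonoid c ℓ) where
  open RawMonoid M

  -- The base 2 expansion with digits w (s 0), w (s 1), …, least significant first.
  digitSum : ∀ {n} → (Fin n → Carrier) → ∀ t → (Fin t → Fin n) → Carrier
  digitSum w zero    s = ε
  digitSum w (suc t) s = w (s zero) ∙ (digitSum w t (s ∘ suc) ∙ digitSum w t (s ∘ suc))

module Mod2 {g ℓg : Level} (G : AbelianGroup g ℓg) where
  open AbelianGroup G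
  open DigitSum rawMonoid
  open Algebra.Properties.AbelianGroup G
  open Algebra.Solver.CommutativeMonoid commutativeMonoid using (solve; _⊕_; _⊜_; id)
  open Relation.Binary.Reasoning.Setoid setoid

  record IsSubgroup {p} (Λ : Pred Carrier p) : Set (g ⊔ ℓg ⊔ p) where
    field
      ∈-resp-≈ : ∀ {x y} → x ≈ y → x ∈ Λ → y ∈ Λ
      ε∈       : ε ∈ Λ
      ∙∈       : ∀ {x y} → x ∈ Λ → y ∈ Λ → x ∙ y ∈ Λ
      ⁻¹∈      : ∀ {x} → x ∈ Λ → x ⁻¹ ∈ Λ

  cancel-inverse : ∀ x y → x ⁻¹ ∙ (y ∙ x) ≈ y
  cancel-inverse x y = begin
    x ⁻¹ ∙ (y ∙ x)  ≈⟨ solve 3 (λ n y x → n ⊕ (y ⊕ x) ⊜ y ⊕ (n ⊕ x)) refl (x ⁻¹) y x ⟩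
    y ∙ (x ⁻¹ ∙ x)  ≈⟨ ∙-congˡ (inverseˡ x) ⟩
    y ∙ ε           ≈⟨ identityʳ y ⟩
    y               ∎

  cancel-doubles : ∀ x y z → (x ∙ (y ∙ y)) ∙ ((z ∙ y ⁻¹) ∙ (z ∙ y ⁻¹)) ≈ x ∙ (z ∙ z)
  cancel-doubles x y z = begin
    (x ∙ (y ∙ y)) ∙ ((z ∙ y ⁻¹) ∙ (z ∙ y ⁻¹))
      ≈⟨ solve 4 (λ x y z n → (x ⊕ (y ⊕ y)) ⊕ ((z ⊕ n) ⊕ (z ⊕ n)) ⊜ (x ⊕ ((n ⊕ (z ⊕ y)) ⊕ (n ⊕ (z ⊕ y))))) refl x y z (y ⁻¹) ⟩
    x ∙ ((y ⁻¹ ∙ (z ∙ y)) ∙ (y ⁻¹ ∙ (z ∙ y)))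
      ≈⟨ ∙-congˡ (∙-cong (cancel-inverse y z) (cancel-inverse y z)) ⟩
    x ∙ (z ∙ z)  ∎

  no-2-torsion⇒halve : (∀ {x} → x ∙ x ≈ ε → x ≈ ε) → ∀ {x y} → x ∙ x ≈ y ∙ y → x ≈ y
  no-2-torsion⇒halve no-torsion {x} {y} eq = x∙y⁻¹≈ε⇒x≈y x y (no-torsion (begin
    (x ∙ y ⁻¹) ∙ (x ∙ y ⁻¹)    ≈⟨ solve 2 (λ x n → (x ⊕ n) ⊕ (x ⊕ n) ⊜ (x ⊕ x) ⊕ (n ⊕ n)) refl x (y ⁻¹) ⟩
    (x ∙ x) ∙ (y ⁻¹ ∙ y ⁻¹)    ≈⟨ ∙-cong eq (⁻¹-∙-comm y y) ⟩
    (y ∙ y) ∙ (y ∙ y) ⁻¹       ≈⟨ inverseʳ (y ∙ y) ⟩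
    ε                          ∎))

  module _ {p} {Λ : Pred Carrier p} (sub : IsSubgroup Λ) where
    open IsSubgroup sub

    infix 4 _≈₂_
    -- Congruence modulo `2Λ`. The witness `z`, half the difference, is what later competes with the
    -- records.
    _≈₂_ : Carrier → Carrier → Set (g ⊔ ℓg ⊔ p)
    x ≈₂ y = ∃ λ z → z ∈ Λ × x ≈ y ∙ (z ∙ z)

    -- Doubles may occur on both sides; the witness is `v - u`. Symmetry and the comparison of last
    -- digits are instances.
    ≈₂-difference : ∀ {x y u v} → u ∈ Λ → v ∈ Λ → x ∙ (u ∙ u) ≈ y ∙ (v ∙ v) → x ≈₂ y
    ≈₂-difference {x} {y} {u} {v} u∈ v∈ eq = v ∙ u ⁻¹ , ∙∈ v∈ (⁻¹∈ u∈) , ∙-cancelʳ (u ∙ u) x _ (begin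
      x ∙ (u ∙ u)   ≈⟨ eq ⟩
      y ∙ (v ∙ v)   ≈⟨ cancel-doubles y u v ⟨
      (y ∙ (u ∙ u)) ∙ ((v ∙ u ⁻¹) ∙ (v ∙ u ⁻¹))
        ≈⟨ solve 3 (λ y u d → (y ⊕ u) ⊕ d ⊜ (y ⊕ d) ⊕ u) refl y (u ∙ u) ((v ∙ u ⁻¹) ∙ (v ∙ u ⁻¹)) ⟩
      (y ∙ ((v ∙ u ⁻¹) ∙ (v ∙ u ⁻¹))) ∙ (u ∙ u) ∎)

    ≈₂-sym : ∀ {x y} → x ≈₂ y → y ≈₂ x
    ≈₂-sym {x} {y} (z , z∈ , x≈) = ≈₂-difference z∈ ε∈
      (trans (sym x≈) (sym (trans (∙-congˡ (identityʳ ε)) (identityʳ x))))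

    ≈₂-cancelʳ : ∀ {x y} u → x ∙ u ≈₂ y ∙ u → x ≈₂ y
    ≈₂-cancelʳ {x} {y} u (z , z∈ , eq) = z , z∈ , ∙-cancelʳ u x _ (begin
      x ∙ u               ≈⟨ eq ⟩
      (y ∙ u) ∙ (z ∙ z)   ≈⟨ solve 3 (λ y u d → (y ⊕ u) ⊕ d ⊜ (y ⊕ d) ⊕ u) refl y u (z ∙ z) ⟩
      (y ∙ (z ∙ z)) ∙ u   ∎)

    ≈₂-respˡ : ∀ {x x′ y} → x ≈ x′ → x ≈₂ y → x′ ≈₂ y
    ≈₂-respˡ eq (z , z∈ , e) = z , z∈ , trans (sym eq) e

    ≈₂-respʳ : ∀ {x y y′} → y ≈ y′ → x ≈₂ y → x ≈₂ y′
    ≈₂-respʳ eq (z , z∈ , e) = z , z∈ , trans e (∙-congʳ eq)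

    -- From `x = y + u + 2z` the halves `(y + u - x)/2`, `(x + u - y)/2` and `(x + y - u)/2` are
    -- `- z`, `u + z` and `y + z`, all in `Λ`.
    midpoints : ∀ {x y u} → y ∈ Λ → u ∈ Λ → x ≈₂ y ∙ u → ∃ λ r → ∃ λ s → ∃ λ t →
                r ∈ Λ × s ∈ Λ × t ∈ Λ × x ≈ s ∙ t × y ≈ r ∙ t × u ≈ r ∙ s
    midpoints {x} {y} {u} y∈ u∈ (z , z∈ , x≈) = z ⁻¹ , u ∙ z , y ∙ z ,
      ⁻¹∈ z∈ , ∙∈ u∈ z∈ , ∙∈ y∈ z∈ ,
      trans x≈ (solve 3 (λ y u z → (y ⊕ u) ⊕ (z ⊕ z) ⊜ (u ⊕ z) ⊕ (y ⊕ z)) refl y u z) ,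
      sym (cancel-inverse z y) , sym (cancel-inverse z u)

    digitSum∈ : ∀ {n} {w : Fin n → Carrier} → (∀ i → w i ∈ Λ) → ∀ t s → digitSum w t s ∈ Λ
    digitSum∈ w∈ zero    s = ε∈
    digitSum∈ w∈ (suc t) s = ∙∈ (w∈ (s zero)) (∙∈ rest rest)
      where rest = digitSum∈ w∈ t (s ∘ suc)

    -- Modulo `2Λ` only the least significant digit survives, so incongruence recovers it.
    -- Cancelling it and halving leaves a shorter expansion.
    digitSum-injective : (∀ {x y} → x ∙ x ≈ y ∙ y → x ≈ y) →
      ∀ {n} {w : Fin n → Carrier} → (∀ i → w i ∈ Λ) → (∀ {i j} → i ≢ j → ¬ w i ≈₂ w j) →
      ∀ t {s s′} → digitSum w t s ≈ digitSum w t s′ → s ≗ s′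
    digitSum-injective halve w∈ incong zero eq ()
    digitSum-injective halve {w = w} w∈ incong (suc t) {s} {s′} eq with s zero Fin.≟ s′ zero
    ... | no s₀≢ = contradiction
      (≈₂-difference (digitSum∈ w∈ t (s ∘ suc)) (digitSum∈ w∈ t (s′ ∘ suc)) eq) (incong s₀≢)
    ... | yes s₀≡ = λ where
      zero    → s₀≡
      (suc i) → digitSum-injective halve w∈ incong t (halve (∙-cancelˡ (w (s zero)) _ _
                  (trans eq (∙-congʳ (reflexive (≡.cong w (≡.sym s₀≡))))))) i

    -- Modulo 2Λ, the set W of the w i does not meet W ∙ w c, so both together
    -- have twice as many elements.
    module Doubling {m} (w : Fin m → Carrier) (c : Fin m) (w∈ : ∀ i → w i ∈ Λ)
      (indivisible : ∀ i → ¬ w i ≈₂ ε)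
      (incongruent : ∀ {i j} → i ≢ j → ¬ w i ≈₂ w j)
      (sum-free : ∀ {i j} → i ≢ j → i ≢ c → j ≢ c → ¬ w i ≈₂ w j ∙ w c) where

      doubled : Fin (m ℕ.+ m) → Carrier
      doubled i = [ w , (λ j → w j ∙ w c) ]′ (splitAt m i)

      doubled∈ : ∀ i → doubled i ∈ Λ
      doubled∈ i with splitAt m i
      ... | inj₁ j = w∈ j
      ... | inj₂ j = ∙∈ (w∈ j) (w∈ c)

      -- If two of `i`, `j`, `c` coincide, cancellation makes some `w` congruent to `ε`, against
      -- `indivisible`. Three distinct indices are the case of `sum-free`.
      shifted-incongruent : ∀ i j → ¬ w i ≈₂ w j ∙ w c
      shifted-incongruent i j cong with i Fin.≟ c | j Fin.≟ c | i Fin.≟ j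
      ... | yes ≡.refl | _ | _ = indivisible j (≈₂-cancelʳ (w c)
              (≈₂-respʳ (sym (identityˡ _)) (≈₂-sym cong)))
      ... | no _ | yes ≡.refl | _ = indivisible i (let (z , z∈ , eq) = cong in
              w c ∙ z , ∙∈ (w∈ c) z∈ ,
              trans eq (solve 2 (λ x z → (x ⊕ x) ⊕ (z ⊕ z) ⊜ id ⊕ ((x ⊕ z) ⊕ (x ⊕ z))) refl (w c) z))
      ... | no _ | no _ | yes ≡.refl = indivisible c (≈₂-cancelʳ (w i)
              (≈₂-respʳ (sym (identityˡ _)) (≈₂-respˡ (comm _ _) (≈₂-sym cong))))
      ... | no i≢c | no j≢c | no i≢j = sum-free i≢j i≢c j≢c cong

      doubled-incongruent : ∀ {i j} → i ≢ j → ¬ doubled i ≈₂ doubled j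
      doubled-incongruent {i} {j} i≢j cong
        with splitAt m i | splitAt m j | Fin.join-splitAt m m i | Fin.join-splitAt m m j
      ... | inj₁ a | inj₁ b | ≡.refl | ≡.refl = incongruent (i≢j ∘ ≡.cong (join m m ∘ inj₁)) cong
      ... | inj₁ a | inj₂ b | _ | _ = shifted-incongruent a b cong
      ... | inj₂ a | inj₁ b | _ | _ = shifted-incongruent b a (≈₂-sym cong)
      ... | inj₂ a | inj₂ b | ≡.refl | ≡.refl =
              incongruent (i≢j ∘ ≡.cong (join m m ∘ inj₂)) (≈₂-cancelʳ (w c) cong)

-- Ordered field arithmetic, the Archimedean property and unit cells.

module Ordered {c ℓ : Level} (ℝ : CompleteOrderedField c ℓ) where
  open CompleteOrderedField ℝ hiding (zero)
  open Relation.Binary.Reasoning.PartialOrder poset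
  open Relation.Binary.Properties.DecTotalOrder decTotalOrder using (≰⇒≥)
  open Algebra.Properties.Ring ring using (-‿distribˡ-*; -‿distribʳ-*; -‿involutive)
  module ℝ-Solver = Algebra.Solver.Ring.NaturalCoefficients.Default commutativeSemiring
  open ℝ-Solver using (solve; _:=_; _:+_; _:*_)
  open Algebra.Definitions.RawMonoid +-rawMonoid using () renaming (_×_ to _⨯_)
  open Algebra.Properties.Monoid.Mult +-monoid using (×-homo-+)
  open DigitSum +-rawMonoid

  +-monoʳ-≤ : ∀ z {x y} → x ≤ y → z + x ≤ z + y
  +-monoʳ-≤ z {x} {y} x≤y = begin
    z + x ≈⟨ +-comm z x ⟩
    x + z ≤⟨ +-monoˡ-≤ z x≤y ⟩
    y + z ≈⟨ +-comm y z ⟩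
    z + y ∎

  +-mono-≤ : ∀ {x y u v} → x ≤ y → u ≤ v → x + u ≤ y + v
  +-mono-≤ {y = y} {u} x≤y u≤v = ≤-trans (+-monoˡ-≤ u x≤y) (+-monoʳ-≤ y u≤v)

  +-nonneg : ∀ {x y} → 0# ≤ x → 0# ≤ y → 0# ≤ x + y
  +-nonneg 0≤x 0≤y = ≤-respˡ-≈ (+-identityʳ 0#) (+-mono-≤ 0≤x 0≤y)

  x-y+y≈x : ∀ x y → (x - y) + y ≈ x
  x-y+y≈x x y = ≈-trans (+-assoc x (- y) y) (≈-trans (+-congˡ (-‿inverseˡ y)) (+-identityʳ x))

  +-cancelʳ-≤ : ∀ z {x y} → x + z ≤ y + z → x ≤ y
  +-cancelʳ-≤ z {x} {y} le = begin
    x              ≈⟨ cancel x ⟨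
    (x + z) - z    ≤⟨ +-monoˡ-≤ (- z) le ⟩
    (y + z) - z    ≈⟨ cancel y ⟩
    y              ∎
    where
    cancel : ∀ w → (w + z) - z ≈ w
    cancel w = ≈-trans (+-assoc w z (- z)) (≈-trans (+-congˡ (-‿inverseʳ z)) (+-identityʳ w))

  +-cancelˡ-≤ : ∀ z {x y} → z + x ≤ z + y → x ≤ y
  +-cancelˡ-≤ z {x} {y} le = +-cancelʳ-≤ z (begin
    x + z ≈⟨ +-comm x z ⟩
    z + x ≤⟨ le ⟩
    z + y ≈⟨ +-comm z y ⟩
    y + z ∎)

  x≤x+y : ∀ x {y} → 0# ≤ y → x ≤ x + y
  x≤x+y x 0≤y = ≤-respˡ-≈ (+-identityʳ x) (+-monoʳ-≤ x 0≤y)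

  x≤y+x : ∀ x {y} → 0# ≤ y → x ≤ y + x
  x≤y+x x 0≤y = ≤-respʳ-≈ (+-comm x _) (x≤x+y x 0≤y)

  x+y≤x⇒y≤0 : ∀ x {y} → x + y ≤ x → y ≤ 0#
  x+y≤x⇒y≤0 x le = +-cancelˡ-≤ x (≤-respʳ-≈ (≈-sym (+-identityʳ x)) le)

  x≤y⇒0≤y-x : ∀ {x y} → x ≤ y → 0# ≤ y - x
  x≤y⇒0≤y-x {x} x≤y = ≤-respˡ-≈ (-‿inverseʳ x) (+-monoˡ-≤ (- x) x≤y)

  x≤0⇒0≤-x : ∀ {x} → x ≤ 0# → 0# ≤ - x
  x≤0⇒0≤-x x≤0 = ≤-respʳ-≈ (+-identityˡ _) (x≤y⇒0≤y-x x≤0)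

  *-monoʳ-≤ : ∀ {z} → 0# ≤ z → ∀ {x y} → x ≤ y → z * x ≤ z * y
  *-monoʳ-≤ {z} 0≤z {x} {y} x≤y = begin
    z * x                ≤⟨ x≤y+x (z * x) (*-nonneg 0≤z (x≤y⇒0≤y-x x≤y)) ⟩
    z * (y - x) + z * x  ≈⟨ distribˡ z (y - x) x ⟨
    z * ((y - x) + x)    ≈⟨ *-congˡ (x-y+y≈x y x) ⟩
    z * y                ∎

  *-monoˡ-≤ : ∀ {z} → 0# ≤ z → ∀ {x y} → x ≤ y → x * z ≤ y * z
  *-monoˡ-≤ {z} 0≤z {x} {y} x≤y = begin
    x * z ≈⟨ *-comm x z ⟩
    z * x ≤⟨ *-monoʳ-≤ 0≤z x≤y ⟩
    z * y ≈⟨ *-comm z y ⟩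
    y * z ∎

  *-mono-≤ : ∀ {x y u v} → 0# ≤ x → 0# ≤ v → x ≤ y → u ≤ v → x * u ≤ y * v
  *-mono-≤ 0≤x 0≤v x≤y u≤v = ≤-trans (*-monoʳ-≤ 0≤x u≤v) (*-monoˡ-≤ 0≤v x≤y)

  square-nonneg : ∀ x → 0# ≤ x * x
  square-nonneg x with total 0# x
  ... | inj₁ 0≤x = *-nonneg 0≤x 0≤x
  ... | inj₂ x≤0 = ≤-respʳ-≈ (begin-equality
    - x * - x      ≈⟨ -‿distribˡ-* x (- x) ⟨
    - (x * - x)    ≈⟨ -‿cong (-‿distribʳ-* x x) ⟨
    - - (x * x)    ≈⟨ -‿involutive (x * x) ⟩
    x * x          ∎) (*-nonneg (x≤0⇒0≤-x x≤0) (x≤0⇒0≤-x x≤0))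

  0≤1 : 0# ≤ 1#
  0≤1 = ≤-respʳ-≈ (*-identityʳ 1#) (square-nonneg 1#)

  square≈0⇒≈0 : ∀ {x} → x * x ≈ 0# → x ≈ 0#
  square≈0⇒≈0 {x} xx≈0 with x ≟ 0#
  ... | yes x≈0 = x≈0
  ... | no  x≉0 with inverse x x≉0
  ...   | i , xi≈1 = begin-equality
    x            ≈⟨ *-identityʳ x ⟨
    x * 1#       ≈⟨ *-congˡ xi≈1 ⟨
    x * (x * i)  ≈⟨ *-assoc x x i ⟨
    (x * x) * i  ≈⟨ *-congʳ xx≈0 ⟩
    0# * i       ≈⟨ zeroˡ i ⟩
    0#           ∎

  square≤1 : ∀ {x} → x ≤ 1# → 0# ≤ 1# + x → x * x ≤ 1#
  square≤1 {x} x≤1 0≤1+x = begin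
    x * x                          ≤⟨ x≤x+y (x * x) (*-nonneg (x≤y⇒0≤y-x x≤1) 0≤1+x) ⟩
    x * x + y * (1# + x)           ≈⟨ +-congˡ (*-congˡ (+-congʳ (x-y+y≈x 1# x))) ⟨
    -- Writing `1#` as `y + x` turns `x² + (1 - x)(1 + x) = 1` into a semiring identity, which the
    -- solver can check.
    x * x + y * ((y + x) + x)
      ≈⟨ solve 2 (λ x y → x :* x :+ y :* ((y :+ x) :+ x) := (y :+ x) :* (y :+ x)) ≈-refl x y ⟩
    (y + x) * (y + x)              ≈⟨ *-cong (x-y+y≈x 1# x) (x-y+y≈x 1# x) ⟩
    1# * 1#                        ≈⟨ *-identityʳ 1# ⟩
    1#                             ∎
    where y = 1# - x

  square-cancel-≤ : ∀ {x y} → 0# ≤ y → x * x ≤ y * y → x ≤ y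
  square-cancel-≤ {x} {y} 0≤y xx≤yy with total x y
  ... | inj₁ x≤y = x≤y
  ... | inj₂ y≤x = ≤-respˡ-≈ (≈-sym x≈y) ≤-refl
    where
    e = x - y
    0≤e : 0# ≤ e
    0≤e = x≤y⇒0≤y-x y≤x
    e≈0 : e ≈ 0#
    e≈0 = square≈0⇒≈0 (antisym (x+y≤x⇒y≤0 (y * y) (begin
      y * y + e * e                      ≤⟨ x≤x+y _ (+-nonneg (*-nonneg 0≤e 0≤y) (*-nonneg 0≤e 0≤y)) ⟩
      (y * y + e * e) + (e * y + e * y)
        ≈⟨ solve 2 (λ e y → (y :* y :+ e :* e) :+ (e :* y :+ e :* y) := (e :+ y) :* (e :+ y)) ≈-refl e y ⟩
      (e + y) * (e + y)                  ≈⟨ *-cong (x-y+y≈x x y) (x-y+y≈x x y) ⟩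
      x * x                              ≤⟨ xx≤yy ⟩
      y * y                              ∎)) (square-nonneg e))
    x≈y : x ≈ y
    x≈y = ≈-trans (≈-sym (x-y+y≈x x y)) (≈-trans (+-congʳ e≈0) (+-identityˡ y))

  double≈0⇒≈0 : ∀ {x} → 0# ≤ x → x + x ≈ 0# → x ≈ 0#
  double≈0⇒≈0 {x} 0≤x x+x≈0 = antisym (≤-respʳ-≈ x+x≈0 (x≤x+y x 0≤x)) 0≤x

  inverse-nonneg : ∀ {x y} → 0# ≤ x → x * y ≈ 1# → 0# ≤ y
  inverse-nonneg {x} {y} 0≤x xy≈1 = ≤-respʳ-≈ (begin-equality
    x * (y * y)  ≈⟨ *-assoc x y y ⟨
    (x * y) * y  ≈⟨ *-congʳ xy≈1 ⟩
    1# * y       ≈⟨ *-identityˡ y ⟩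
    y            ∎) (*-nonneg 0≤x (square-nonneg y))

  ι : ℕ → Carrier
  ι n = n ⨯ 1#

  ι-nonneg : ∀ n → 0# ≤ ι n
  ι-nonneg zero    = ≤-refl
  ι-nonneg (suc n) = +-nonneg 0≤1 (ι-nonneg n)

  ι-+ : ∀ m n → ι (m ℕ.+ n) ≈ ι m + ι n
  ι-+ m n = ×-homo-+ 1# m n

  -- If the naturals were bounded, their supremum `s` would not be least: with `ι (suc n) ≤ s` for
  -- all `n`, also `s - 1#` is an upper bound.
  archimedean : ∀ x → ¬ (∀ n → ι n ≤ x)
  archimedean x bound = 0≉1 (antisym 0≤1 (x+y≤x⇒y≤0 s (begin
    s + 1#           ≤⟨ +-monoˡ-≤ 1# (proj₂ (proj₂ sup) (s - 1#) below) ⟩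
    (s - 1#) + 1#    ≈⟨ x-y+y≈x s 1# ⟩
    s                ∎)))
    where
    S : Pred Carrier (c ⊔ ℓ)
    S y = Lift c (∃ λ n → y ≈ ι n)
    sup = supremum S (0# , lift (0 , ≈-refl)) (x , λ { y (lift (n , y≈)) → ≤-respˡ-≈ (≈-sym y≈) (bound n) })
    s = proj₁ sup
    below : UpperBound S (s - 1#)
    below y (lift (n , y≈)) = +-cancelʳ-≤ 1# (begin
      y + 1#         ≈⟨ +-congʳ y≈ ⟩
      ι n + 1#       ≈⟨ +-comm (ι n) 1# ⟩
      ι (suc n)      ≤⟨ proj₁ (proj₂ sup) _ (lift (suc n , ≈-refl)) ⟩
      s              ≈⟨ x-y+y≈x s 1# ⟨
      (s - 1#) + 1#  ∎)

  upperBound : ∀ {n} (f : Fin n → Carrier) → ∃ λ x → ∀ i → f i ≤ x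
  upperBound {zero}  f = 0# , λ ()
  upperBound {suc n} f with upperBound (f ∘ suc)
  ... | x , f≤x with total (f zero) x
  ...   | inj₁ f₀≤x = x , λ { zero → f₀≤x ; (suc i) → f≤x i }
  ...   | inj₂ x≤f₀ = f zero , λ { zero → ≤-refl ; (suc i) → ≤-trans (f≤x i) x≤f₀ }

  upperBound₂ : ∀ x y → ∃ λ z → x ≤ z × y ≤ z
  upperBound₂ x y with total x y
  ... | inj₁ x≤y = y , x≤y , ≤-refl
  ... | inj₂ y≤x = x , ≤-refl , y≤x

  -- Cell j is the interval (j , j + 1], extended beyond all bounds for j = 0 and j = K.
  cell : ∀ K → Carrier → Fin (suc K)
  cell zero    x = zero
  cell (suc K) x with x ≤? 1#
  ... | yes _ = zero
  ... | no  _ = suc (cell K (x - 1#))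

  -- The two bounds handle the unbounded end cells: the one on `x` serves in the last cell, the one
  -- on `y` in cell `0`. The conclusion is one-sided and gets applied in both directions.
  cell-close : ∀ K {x y} → x ≤ ι (suc K) → 0# ≤ y → cell K x ≡ cell K y → x ≤ 1# + y
  cell-close zero {x} {y} x≤ 0≤y _ = ≤-trans x≤ (+-monoʳ-≤ 1# 0≤y)
  cell-close (suc K) {x} {y} x≤ 0≤y eq with x ≤? 1# | y ≤? 1#
  cell-close (suc K) {x} {y} x≤ 0≤y eq | yes x≤1 | _ = ≤-trans x≤1 (x≤x+y 1# 0≤y)
  cell-close (suc K) {x} {y} x≤ 0≤y eq | no _ | no y≰1 = begin
    x                     ≈⟨ x-y+y≈x x 1# ⟨
    (x - 1#) + 1#         ≤⟨ +-monoˡ-≤ 1# (cell-close K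
                               (+-cancelʳ-≤ 1# (≤-respˡ-≈ (≈-sym (x-y+y≈x x 1#)) (≤-respʳ-≈ (+-comm 1# _) x≤)))
                               (x≤y⇒0≤y-x (≰⇒≥ y≰1)) (Fin.suc-injective eq)) ⟩
    1# + (y - 1#) + 1#    ≈⟨ +-assoc 1# (y - 1#) 1# ⟩
    1# + ((y - 1#) + 1#)  ≈⟨ +-congˡ (x-y+y≈x y 1#) ⟩
    1# + y                ∎

  module _ {n C : ℕ} {f : Fin n → Carrier} where
    digitSum-upper : (∀ i → f i ≤ ι C) → ∀ t s → digitSum f t s ≤ ι (binaryBound C t)
    digitSum-upper f≤ zero    s = ≤-refl
    digitSum-upper f≤ (suc t) s = begin
      f (s zero) + (x + x)  ≤⟨ +-mono-≤ (f≤ (s zero)) (+-mono-≤ x≤ x≤) ⟩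
      ι C + (ι b + ι b)     ≈⟨ +-congˡ (ι-+ b b) ⟨
      ι C + ι (b ℕ.+ b)     ≈⟨ ι-+ C (b ℕ.+ b) ⟨
      ι (C ℕ.+ (b ℕ.+ b))   ∎
      where
      b = binaryBound C t
      x = digitSum f t (s ∘ suc)
      x≤ = digitSum-upper f≤ t (s ∘ suc)

    digitSum-lower : (∀ i → 0# ≤ ι C + f i) → ∀ t s → 0# ≤ ι (binaryBound C t) + digitSum f t s
    digitSum-lower ≤f zero    s = ≤-respʳ-≈ (≈-sym (+-identityʳ 0#)) ≤-refl
    digitSum-lower ≤f (suc t) s = begin
      0#                                      ≤⟨ +-nonneg (≤f (s zero)) (+-nonneg ≤x ≤x) ⟩
      (ι C + f₀) + ((ι b + x) + (ι b + x))
        ≈⟨ solve 4 (λ c f b x → (c :+ f) :+ ((b :+ x) :+ (b :+ x)) := (c :+ (b :+ b)) :+ (f :+ (x :+ x))) ≈-refl (ι C) f₀ (ι b) x ⟩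
      (ι C + (ι b + ι b)) + (f₀ + (x + x))    ≈⟨ +-congʳ (≈-trans (ι-+ C (b ℕ.+ b)) (+-congˡ (ι-+ b b))) ⟨
      ι (C ℕ.+ (b ℕ.+ b)) + (f₀ + (x + x))    ∎
      where
      b = binaryBound C t
      f₀ = f (s zero)
      x = digitSum f t (s ∘ suc)
      ≤x = digitSum-lower ≤f t (s ∘ suc)

    module _ (f≤ : ∀ i → f i ≤ ι C) (≤f : ∀ i → 0# ≤ ι C + f i) (t : ℕ) where
      private b = binaryBound C t

      -- Adding `ι b` moves the range from `- b` to `b` of the digit sums to the range from `0` to
      -- `2b` that the cells cover.
      digitCell : (Fin t → Fin n) → Fin (suc (b ℕ.+ b))
      digitCell s = cell (b ℕ.+ b) (ι b + digitSum f t s)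

      digitCell-close : ∀ s s′ → digitCell s ≡ digitCell s′ → digitSum f t s ≤ 1# + digitSum f t s′
      digitCell-close s s′ eq = +-cancelˡ-≤ (ι b) (begin
        ι b + digitSum f t s         ≤⟨ cell-close (b ℕ.+ b) (begin
          ι b + digitSum f t s         ≤⟨ +-monoʳ-≤ (ι b) (digitSum-upper f≤ t s) ⟩
          ι b + ι b                    ≈⟨ ι-+ b b ⟨
          ι (b ℕ.+ b)                  ≤⟨ x≤y+x _ 0≤1 ⟩
          ι (suc (b ℕ.+ b))            ∎) (digitSum-lower ≤f t s′) eq ⟩
        1# + (ι b + digitSum f t s′)
          ≈⟨ solve 3 (λ u b x → u :+ (b :+ x) := b :+ (u :+ x)) ≈-refl 1# (ι b) (digitSum f t s′) ⟩
        ι b + (1# + digitSum f t s′) ∎)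

-- Geometry of the squared norm, preceded by two facts on integers.

ℤ-halve : ∀ {i j} → i ℤ.+ i ≡ j ℤ.+ j → i ≡ j
ℤ-halve {i} {j} eq with ℤ.<-cmp i j
... | tri< i<j _ _ = contradiction eq (ℤ.<⇒≢ (ℤ.+-mono-< i<j i<j))
... | tri≈ _ i≡j _ = i≡j
... | tri> _ _ j<i = contradiction (≡.sym eq) (ℤ.<⇒≢ (ℤ.+-mono-< j<i j<i))

ℕ-upperBound : ∀ {n} (f : Fin n → ℕ) → ∃ λ C → ∀ i → f i ℕ.≤ C
ℕ-upperBound {zero}  f = 0 , λ ()
ℕ-upperBound {suc n} f with ℕ-upperBound (f ∘ suc)
... | C , f≤C = f zero ℕ.+ C , λ where
  zero    → ℕ.m≤m+n (f zero) C
  (suc i) → ℕ.≤-trans (f≤C i) (ℕ.m≤n+m C (f zero))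

module Space {c ℓ v ℓv : Level} {ℝ : CompleteOrderedField c ℓ} (V : InnerProductSpace ℝ v ℓv) where
  open CompleteOrderedField ℝ hiding (zero)
  open InnerProductSpace V
  open Ordered ℝ
  open ℝ-Solver using (solve; _:=_; _:+_)
  module V-Solver = Algebra.Solver.CommutativeMonoid +ᴹ-commutativeMonoid
  open Relation.Binary.Reasoning.PartialOrder poset
  module V-Group = Algebra.Properties.AbelianGroup +ᴹ-abelianGroup

  -- The squared norm; square roots enter only when records are compared with `δ`.
  q : Carrierᴹ → Carrier
  q x = ⟨ x , x ⟩

  q-cong : ∀ {x y} → x ≈ᴹ y → q x ≈ q y
  q-cong x≈y = ⟨⟩-cong x≈y x≈y

  q-scale : ∀ r x → q (r *ₗ x) ≈ r * (r * q x)
  q-scale r x = ≈-trans (⟨⟩-* r x (r *ₗ x))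
    (*-congˡ (≈-trans (⟨⟩-sym x (r *ₗ x)) (⟨⟩-* r x x)))

  q-0 : q 0ᴹ ≈ 0#
  q-0 = ≈-trans (q-cong (≈ᴹ-sym (*ₗ-zeroˡ 0ᴹ))) (≈-trans (q-scale 0# 0ᴹ) (zeroˡ _))

  ⟨⟩-+ʳ : ∀ x y z → ⟨ x , y +ᴹ z ⟩ ≈ ⟨ x , y ⟩ + ⟨ x , z ⟩
  ⟨⟩-+ʳ x y z = ≈-trans (⟨⟩-sym x (y +ᴹ z)) (≈-trans (⟨⟩-+ y z x) (+-cong (⟨⟩-sym y x) (⟨⟩-sym z x)))

  q-+ : ∀ x y → q (x +ᴹ y) ≈ q x + (⟨ x , y ⟩ + ⟨ x , y ⟩) + q y
  q-+ x y = begin-equality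
    ⟨ x +ᴹ y , x +ᴹ y ⟩                            ≈⟨ ⟨⟩-+ x y (x +ᴹ y) ⟩
    ⟨ x , x +ᴹ y ⟩ + ⟨ y , x +ᴹ y ⟩                ≈⟨ +-cong (⟨⟩-+ʳ x x y) (⟨⟩-+ʳ y x y) ⟩
    (q x + ⟨ x , y ⟩) + (⟨ y , x ⟩ + q y)          ≈⟨ +-congˡ (+-congʳ (⟨⟩-sym y x)) ⟩
    (q x + ⟨ x , y ⟩) + (⟨ x , y ⟩ + q y)
      ≈⟨ solve 3 (λ a b c → (a :+ b) :+ (b :+ c) := a :+ (b :+ b) :+ c) ≈-refl (q x) ⟨ x , y ⟩ (q y) ⟩
    q x + (⟨ x , y ⟩ + ⟨ x , y ⟩) + q y            ∎

  q-double : ∀ x → q (x +ᴹ x) ≈ (q x + q x) + (q x + q x)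
  q-double x = ≈-trans (q-+ x x)
    (solve 1 (λ a → a :+ (a :+ a) :+ a := (a :+ a) :+ (a :+ a)) ≈-refl (q x))

  -- The parallelogram law for the parallelogram with sides x + z and z.
  parallelogram : ∀ x z → q (x +ᴹ (z +ᴹ z)) + q x ≈ (q (x +ᴹ z) + q (x +ᴹ z)) + (q z + q z)
  parallelogram x z = begin-equality
    q (x +ᴹ (z +ᴹ z)) + q x
      ≈⟨ +-congʳ (≈-trans (q-+ x (z +ᴹ z)) (+-cong (+-congˡ (+-cong (⟨⟩-+ʳ x z z) (⟨⟩-+ʳ x z z))) (q-double z))) ⟩
    (q x + ((⟨ x , z ⟩ + ⟨ x , z ⟩) + (⟨ x , z ⟩ + ⟨ x , z ⟩)) + ((q z + q z) + (q z + q z))) + q x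
      ≈⟨ solve 3 (λ a b c → (a :+ ((b :+ b) :+ (b :+ b)) :+ ((c :+ c) :+ (c :+ c))) :+ a
                         := ((a :+ (b :+ b) :+ c) :+ (a :+ (b :+ b) :+ c)) :+ (c :+ c)) ≈-refl (q x) ⟨ x , z ⟩ (q z) ⟩
    ((q x + (⟨ x , z ⟩ + ⟨ x , z ⟩) + q z) + (q x + (⟨ x , z ⟩ + ⟨ x , z ⟩) + q z)) + (q z + q z)
      ≈⟨ +-congʳ (+-cong (q-+ x z) (q-+ x z)) ⟨
    (q (x +ᴹ z) + q (x +ᴹ z)) + (q z + q z) ∎

  -- The parallelogram law for `x` and `y` with the term `q (x -ᴹ y)` dropped.
  q-+-≤ : ∀ x y → q (x +ᴹ y) ≤ (q x + q x) + (q y + q y)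
  q-+-≤ x y = begin
    q (x +ᴹ y)                                        ≤⟨ x≤x+y _ (⟨⟩-nonneg (x -ᴹ y)) ⟩
    q (x +ᴹ y) + q (x -ᴹ y)                           ≈⟨ +-congʳ (q-cong (≈ᴹ-trans (+ᴹ-congʳ (≈ᴹ-sym x-y+y)) (+ᴹ-assoc _ y y))) ⟩
    q ((x -ᴹ y) +ᴹ (y +ᴹ y)) + q (x -ᴹ y)             ≈⟨ parallelogram (x -ᴹ y) y ⟩
    (q ((x -ᴹ y) +ᴹ y) + q ((x -ᴹ y) +ᴹ y)) + (q y + q y)  ≈⟨ +-congʳ (+-cong (q-cong x-y+y) (q-cong x-y+y)) ⟩
    (q x + q x) + (q y + q y)                         ∎
    where
    x-y+y : (x -ᴹ y) +ᴹ y ≈ᴹ x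
    x-y+y = V-Group.//-rightDividesˡ y x

  -- The defect is q (x + y + z).
  hexagon : ∀ x y z → q x + q y + q z ≤ q (y +ᴹ z) + q (x +ᴹ z) + q (x +ᴹ y)
  hexagon x y z = begin
    q x + q y + q z   ≤⟨ x≤x+y _ (⟨⟩-nonneg (x +ᴹ y +ᴹ z)) ⟩
    (q x + q y + q z) + q (x +ᴹ y +ᴹ z)
      ≈⟨ +-congˡ (≈-trans (q-+ (x +ᴹ y) z) (+-congʳ (+-cong (q-+ x y) (+-cong (⟨⟩-+ x y z) (⟨⟩-+ x y z))))) ⟩
    (q x + q y + q z) + ((q x + (xy + xy) + q y) + ((xz + yz) + (xz + yz)) + q z)
      ≈⟨ solve 6 (λ x y z xy xz yz →
           (x :+ y :+ z) :+ ((x :+ (xy :+ xy) :+ y) :+ ((xz :+ yz) :+ (xz :+ yz)) :+ z)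
           := (y :+ (yz :+ yz) :+ z) :+ (x :+ (xz :+ xz) :+ z) :+ (x :+ (xy :+ xy) :+ y))
         ≈-refl (q x) (q y) (q z) xy xz yz ⟩
    (q y + (yz + yz) + q z) + (q x + (xz + xz) + q z) + (q x + (xy + xy) + q y)
      ≈⟨ +-cong (+-cong (q-+ y z) (q-+ x z)) (q-+ x y) ⟨
    q (y +ᴹ z) + q (x +ᴹ z) + q (x +ᴹ y) ∎
    where
    xy = ⟨ x , y ⟩
    xz = ⟨ x , z ⟩
    yz = ⟨ y , z ⟩

  double≈0ᴹ : ∀ {x} → x +ᴹ x ≈ᴹ 0ᴹ → x ≈ᴹ 0ᴹ
  double≈0ᴹ {x} eq = ⟨⟩-definite x (double≈0⇒≈0 (⟨⟩-nonneg x)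
    (double≈0⇒≈0 (+-nonneg (⟨⟩-nonneg x) (⟨⟩-nonneg x))
      (≈-trans (≈-sym (q-double x)) (≈-trans (q-cong eq) q-0))))

  linearCombination-0 : ∀ {k} (b : Fin k → Carrierᴹ) → linearCombination (λ _ → 0#) b ≈ᴹ 0ᴹ
  linearCombination-0 {zero}  b = ≈ᴹ-refl
  linearCombination-0 {suc k} b = ≈ᴹ-trans (+ᴹ-cong (*ₗ-zeroˡ (b zero)) (linearCombination-0 (b ∘ suc))) (+ᴹ-identityˡ 0ᴹ)

  linearCombination-+ : ∀ {k} (r s : Fin k → Carrier) (b : Fin k → Carrierᴹ) →
    linearCombination (λ i → r i + s i) b ≈ᴹ linearCombination r b +ᴹ linearCombination s b
  linearCombination-+ {zero}  r s b = ≈ᴹ-sym (+ᴹ-identityˡ 0ᴹ)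
  linearCombination-+ {suc k} r s b = ≈ᴹ-trans
    (+ᴹ-cong (*ₗ-distribʳ (b zero) (r zero) (s zero)) (linearCombination-+ (r ∘ suc) (s ∘ suc) (b ∘ suc)))
    (V-Solver.solve 4 (λ x y z w → (x ⊕ y) ⊕ (z ⊕ w) ⊜ (x ⊕ z) ⊕ (y ⊕ w)) ≈ᴹ-refl _ _ _ _)
    where open V-Solver using (_⊕_; _⊜_)

  -- The bound that repeated use of `q-+-≤` yields for a combination with coefficients between `-1`
  -- and `1`. It depends on `b` alone.
  unitBoxBound : ∀ {k} → (Fin k → Carrierᴹ) → Carrier
  unitBoxBound {zero}  b = 0#
  unitBoxBound {suc k} b = (q (b zero) + q (b zero)) + (unitBoxBound (b ∘ suc) + unitBoxBound (b ∘ suc))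

  unitBoxBound-nonneg : ∀ {k} (b : Fin k → Carrierᴹ) → 0# ≤ unitBoxBound b
  unitBoxBound-nonneg {zero}  b = ≤-refl
  unitBoxBound-nonneg {suc k} b = +-nonneg (+-nonneg 0≤q 0≤q) (+-nonneg 0≤r 0≤r)
    where
    0≤q = ⟨⟩-nonneg (b zero)
    0≤r = unitBoxBound-nonneg (b ∘ suc)

  -- The hypotheses place each `r e - s e` between `-1` and `1`, in the form that `digitCell-close`
  -- delivers. Basis vectors are split off one at a time.
  close-combinations : ∀ {k} {r s : Fin k → Carrier} (b : Fin k → Carrierᴹ) →
    (∀ e → r e ≤ 1# + s e) → (∀ e → s e ≤ 1# + r e) →
    q (linearCombination r b -ᴹ linearCombination s b) ≤ unitBoxBound b
  close-combinations {zero}          b r≤ s≤ = ≤-respˡ-≈ (≈-sym (≈-trans (q-cong (-ᴹ‿inverseʳ 0ᴹ)) q-0)) ≤-refl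
  close-combinations {suc k} {r} {s} b r≤ s≤ = begin
    q ((r zero *ₗ b zero +ᴹ R) -ᴹ (s zero *ₗ b zero +ᴹ S))  ≈⟨ q-cong split ⟩
    q ((r zero - s zero) *ₗ b zero +ᴹ (R -ᴹ S))              ≤⟨ q-+-≤ _ _ ⟩
    (q₀ + q₀) + (q (R -ᴹ S) + q (R -ᴹ S))
      ≤⟨ +-mono-≤ (+-mono-≤ q₀≤ q₀≤) (+-mono-≤ rest rest) ⟩
    unitBoxBound b ∎
    where
    open V-Solver using (_⊕_; _⊜_)
    R = linearCombination (r ∘ suc) (b ∘ suc)
    S = linearCombination (s ∘ suc) (b ∘ suc)
    x = r zero - s zero
    q₀ = q (x *ₗ b zero)
    rest = close-combinations (b ∘ suc) (r≤ ∘ suc) (s≤ ∘ suc)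
    split : (r zero *ₗ b zero +ᴹ R) -ᴹ (s zero *ₗ b zero +ᴹ S) ≈ᴹ x *ₗ b zero +ᴹ (R -ᴹ S)
    split = ≈ᴹ-trans (+ᴹ-congʳ (≈ᴹ-sym (≈ᴹ-trans
      (V-Solver.solve 4 (λ x s d S → (x ⊕ d) ⊕ (s ⊕ S) ⊜ (x ⊕ s) ⊕ (d ⊕ S)) ≈ᴹ-refl (x *ₗ b zero) (s zero *ₗ b zero) (R -ᴹ S) S)
      (+ᴹ-cong (≈ᴹ-trans (≈ᴹ-sym (*ₗ-distribʳ (b zero) x (s zero))) (*ₗ-congʳ (x-y+y≈x (r zero) (s zero))))
               (V-Group.//-rightDividesˡ S R)))))
      (V-Group.//-rightDividesʳ (s zero *ₗ b zero +ᴹ S) (x *ₗ b zero +ᴹ (R -ᴹ S)))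
    x≤1 : x ≤ 1#
    x≤1 = +-cancelʳ-≤ (s zero) (≤-respˡ-≈ (≈-sym (x-y+y≈x (r zero) (s zero))) (r≤ zero))
    0≤1+x : 0# ≤ 1# + x
    0≤1+x = +-cancelʳ-≤ (s zero) (begin
      0# + s zero        ≈⟨ +-identityˡ _ ⟩
      s zero             ≤⟨ s≤ zero ⟩
      1# + r zero        ≈⟨ +-congˡ (x-y+y≈x (r zero) (s zero)) ⟨
      1# + (x + s zero)  ≈⟨ +-assoc 1# x (s zero) ⟨
      1# + x + s zero    ∎)
    q₀≤ : q₀ ≤ q (b zero)
    q₀≤ = begin
      q (x *ₗ b zero)       ≈⟨ q-scale x (b zero) ⟩
      x * (x * q (b zero))  ≈⟨ *-assoc x x _ ⟨
      (x * x) * q (b zero)  ≤⟨ *-monoˡ-≤ (⟨⟩-nonneg (b zero)) (square≤1 x≤1 0≤1+x) ⟩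
      1# * q (b zero)       ≈⟨ *-identityˡ _ ⟩
      q (b zero)            ∎

  ℤ×V : AbelianGroup v ℓv
  ℤ×V = Algebra.Construct.DirectProduct.abelianGroup ℤ.+-0-abelianGroup +ᴹ-abelianGroup

  module ℤ×V = AbelianGroup ℤ×V
  ℤ×V-halve : ∀ {x y : ℤ×V.Carrier} → x ℤ×V.∙ x ℤ×V.≈ y ℤ×V.∙ y → x ℤ×V.≈ y
  ℤ×V-halve (eqℤ , eqV) = ℤ-halve eqℤ , Mod2.no-2-torsion⇒halve +ᴹ-abelianGroup double≈0ᴹ eqV

-- At most `2 ^ (1 + d)` classes of points of natural height modulo `2Λ`.

ℕ-digitSum-≤ : ∀ {n C} {k : Fin n → ℕ} → (∀ i → k i ℕ.≤ C) → ∀ t s →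
               DigitSum.digitSum ℕ.+-0-rawMonoid k t s ℕ.≤ binaryBound C t
ℕ-digitSum-≤ k≤ zero    s = ℕ.z≤n
ℕ-digitSum-≤ k≤ (suc t) s = ℕ.+-mono-≤ (k≤ (s zero)) (ℕ.+-mono-≤ rest rest)
  where rest = ℕ-digitSum-≤ k≤ t (s ∘ suc)

module Cosets {c ℓ v ℓv : Level} {ℝ : CompleteOrderedField c ℓ} (V : InnerProductSpace ℝ v ℓv) where
  open CompleteOrderedField ℝ hiding (zero)
  open InnerProductSpace V
  open Ordered ℝ
  open Space V
  open Mod2 ℤ×V
  open Relation.Binary.Reasoning.PartialOrder poset
  open DigitSum using (digitSum)

  module _ {d p} {b : Fin d → Carrierᴹ} (span : ∀ y → ∃ λ r → y ≈ᴹ linearCombination r b)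
           {Λ : Pred ℤ×V.Carrier p} (sub : IsSubgroup Λ)
           {ε : Carrier} (0≤ε : 0# ≤ ε) (ε≉0 : ε ≉ 0#)
           (separated : ∀ {y} → (+ 0 , y) ∈ Λ → ¬ ε ≤ q y → y ≈ᴹ 0ᴹ) where
    open IsSubgroup sub

    module _ {n} (2^[1+d]<n : 2 ℕ.^ suc d ℕ.< n) {w : Fin n → ℤ×V.Carrier} (w∈ : ∀ i → w i ∈ Λ)
             {k : Fin n → ℕ} (w-height : ∀ i → proj₁ (w i) ≡ + k i)
             (incongruent : ∀ {i j} → i ≢ j → ¬ _≈₂_ sub (w i) (w j)) where

      private
        y : ∀ t → (Fin t → Fin n) → Carrierᴹ
        y t s = proj₂ (digitSum ℤ×V.rawMonoid w t s)

        h : ∀ t → (Fin t → Fin n) → ℕ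
        h = digitSum ℕ.+-0-rawMonoid k

        y-height : ∀ t s → proj₁ (digitSum ℤ×V.rawMonoid w t s) ≡ + h t s
        y-height zero    s = ≡.refl
        y-height (suc t) s = ≡.cong₂ (λ z z′ → z ℤ.+ (z′ ℤ.+ z′)) (w-height (s zero)) (y-height t (s ∘ suc))

        D : Carrier
        D = unitBoxBound b

        i : Carrier
        i = proj₁ (inverse ε ε≉0)
        εi≈1 : ε * i ≈ 1#
        εi≈1 = proj₂ (inverse ε ε≉0)

        -- Scaling by a turns the separation ε into more than the size D of a unit cell.
        a : Carrier
        a = 1# + D * i
        0≤Di : 0# ≤ D * i
        0≤Di = *-nonneg (unitBoxBound-nonneg b) (inverse-nonneg 0≤ε εi≈1)
        0≤a : 0# ≤ a
        0≤a = +-nonneg 0≤1 0≤Di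
        aε≈ε+D : a * ε ≈ ε + D
        aε≈ε+D = begin-equality
          (1# + D * i) * ε       ≈⟨ distribʳ ε 1# (D * i) ⟩
          1# * ε + D * i * ε     ≈⟨ +-cong (*-identityˡ ε) (*-assoc D i ε) ⟩
          ε + D * (i * ε)        ≈⟨ +-congˡ (*-congˡ (≈-trans (*-comm i ε) εi≈1)) ⟩
          ε + D * 1#             ≈⟨ +-congˡ (*-identityʳ D) ⟩
          ε + D                  ∎

        scaled-separation : ∀ {u} → q (a *ₗ u) ≤ D → ¬ ε ≤ q u
        scaled-separation {u} le ε≤ = ε≉0 (antisym (x+y≤x⇒y≤0 D (begin
          D + ε              ≈⟨ +-comm D ε ⟩
          ε + D              ≈⟨ aε≈ε+D ⟨
          a * ε              ≈⟨ *-identityˡ _ ⟨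
          1# * (a * ε)       ≤⟨ *-mono-≤ 0≤1 (*-nonneg 0≤a (⟨⟩-nonneg u)) (x≤x+y 1# 0≤Di) (*-monoʳ-≤ 0≤a ε≤) ⟩
          a * (a * q u)      ≈⟨ q-scale a u ⟨
          q (a *ₗ u)         ≤⟨ le ⟩
          D                  ∎)) 0≤ε)

        ρ : Fin d → Fin n → Carrier
        ρ e i = proj₁ (span (a *ₗ proj₂ (w i))) e

        -- Coordinates of the scaled expansion, assembled from the coordinates of its digits instead
        -- of chosen anew by `span`; thus the bounds on digit sums apply.
        P : ∀ t → (Fin t → Fin n) → Fin d → Carrier
        P t s e = digitSum +-rawMonoid (ρ e) t s

        y-coordinates : ∀ t s → a *ₗ y t s ≈ᴹ linearCombination (P t s) b
        y-coordinates zero    s = ≈ᴹ-trans (*ₗ-zeroʳ a) (≈ᴹ-sym (linearCombination-0 b))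
        y-coordinates (suc t) s = ≈ᴹ-trans (≈ᴹ-trans (*ₗ-distribˡ a _ _) (+ᴹ-congˡ (*ₗ-distribˡ a _ _)))
          (≈ᴹ-trans (+ᴹ-cong (proj₂ (span (a *ₗ proj₂ (w (s zero))))) (≈ᴹ-trans (+ᴹ-cong rest rest) (≈ᴹ-sym (linearCombination-+ _ _ b))))
                    (≈ᴹ-sym (linearCombination-+ _ _ b)))
          where rest = y-coordinates t (s ∘ suc)

        module _ {C} (k≤ : ∀ i → k i ℕ.≤ C) (ρ≤ : ∀ e i → ρ e i ≤ ι C) (≤ρ : ∀ e i → 0# ≤ ι C + ρ e i) (t : ℕ) where
          B : ℕ
          B = binaryBound C t ℕ.+ binaryBound C t

          h<B : ∀ s → h t s ℕ.< suc B
          h<B s = ℕ.s≤s (ℕ.≤-trans (ℕ-digitSum-≤ k≤ t s) (ℕ.m≤m+n _ _))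

          -- The height is kept exactly, as coordinate `zero`. It is placed in `Fin (suc B)` so that
          -- all `1 + d` coordinates have the same number of cells.
          cells : (Fin t → Fin n) → Fin (suc d) → Fin (suc B)
          cells s zero    = fromℕ< (h<B s)
          cells s (suc e) = digitCell (ρ≤ e) (≤ρ e) t s

          -- Equal heights put the difference at height 0; close coordinates give its scaled form
          -- squared norm at most `D`. By separation it vanishes, and `digitSum-injective` applies.
          same-cells : ∀ s s′ → (∀ e → cells s e ≡ cells s′ e) → ∀ e → s e ≡ s′ e
          same-cells s s′ same = digitSum-injective sub ℤ×V-halve w∈ incongruent t
            (height , V-Group.x∙y⁻¹≈ε⇒x≈y _ _ (separated difference∈ (scaled-separation (begin
              q (a *ₗ (y t s -ᴹ y t s′))  ≈⟨ q-cong scaled-difference ⟩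
              q (linearCombination (P t s) b -ᴹ linearCombination (P t s′) b)
                ≤⟨ close-combinations b
                     (λ e → digitCell-close (ρ≤ e) (≤ρ e) t s s′ (same (suc e)))
                     (λ e → digitCell-close (ρ≤ e) (≤ρ e) t s′ s (≡.sym (same (suc e)))) ⟩
              D                           ∎))))
            where
            height : proj₁ (digitSum ℤ×V.rawMonoid w t s) ≡ proj₁ (digitSum ℤ×V.rawMonoid w t s′)
            height = ≡.trans (y-height t s) (≡.trans
              (≡.cong +_ (Fin.fromℕ<-injective _ _ (h<B s) (h<B s′) (same zero))) (≡.sym (y-height t s′)))
            difference∈ : (+ 0 , y t s -ᴹ y t s′) ∈ Λ
            difference∈ = ∈-resp-≈
              (≡.trans (≡.cong (ℤ._- proj₁ (digitSum ℤ×V.rawMonoid w t s′)) height)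
                       (ℤ.+-inverseʳ (proj₁ (digitSum ℤ×V.rawMonoid w t s′))) , ≈ᴹ-refl)
              (∙∈ (digitSum∈ sub w∈ t s) (⁻¹∈ (digitSum∈ sub w∈ t s′)))
            scaled-difference : a *ₗ (y t s -ᴹ y t s′) ≈ᴹ linearCombination (P t s) b -ᴹ linearCombination (P t s′) b
            scaled-difference = V-Group.∙-cancelʳ (linearCombination (P t s′) b) _ _ (≈ᴹ-trans
              (≈ᴹ-trans (+ᴹ-congˡ (≈ᴹ-sym (y-coordinates t s′))) (≈ᴹ-trans (≈ᴹ-sym (*ₗ-distribˡ a _ _))
                (≈ᴹ-trans (*ₗ-congˡ (V-Group.//-rightDividesˡ (y t s′) (y t s))) (y-coordinates t s))))
              (≈ᴹ-sym (V-Group.//-rightDividesˡ _ _)))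

        bounded⇒⊥ : ∀ {C} → (∀ i → k i ℕ.≤ C) → (∀ e i → ρ e i ≤ ι C) → (∀ e i → 0# ≤ ι C + ρ e i) → ⊥
        bounded⇒⊥ {C} k≤ ρ≤ ≤ρ with few-cells C (suc d) 2^[1+d]<n
        ... | t , fewer with pigeonhole-→ fewer (cells k≤ ρ≤ ≤ρ t)
        ...   | s , s′ , s≢s′ , same = s≢s′ (same-cells k≤ ρ≤ ≤ρ t s s′ same)

      -- The n ^ t base 2 expansions of length t with digits w i are distinct, but lie in
      -- a box which meets only O(2 ^ (t * (1 + d))) cells containing at most one element of Λ.
      too-many-cosets : ⊥
      -- `archimedean` yields no explicit integer above `Z`. Refuting `Z ≤ ι m` for each `m` makes
      -- `Z` a bound for all naturals.
      too-many-cosets = archimedean Z λ m → case total (ι m) Z of λ where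
          (inj₁ ιm≤Z) → ιm≤Z
          (inj₂ Z≤ιm) → ⊥-elim (unbounded m Z≤ιm)
        where
        upper : ∃ λ x → ∀ e → proj₁ (upperBound (ρ e)) ≤ x
        upper = upperBound (λ e → proj₁ (upperBound (ρ e)))
        lower : ∃ λ x → ∀ e → proj₁ (upperBound (λ i → - ρ e i)) ≤ x
        lower = upperBound (λ e → proj₁ (upperBound (λ i → - ρ e i)))
        both : ∃ λ z → proj₁ upper ≤ z × proj₁ lower ≤ z
        both = upperBound₂ (proj₁ upper) (proj₁ lower)
        Z : Carrier
        Z = proj₁ both
        ρ≤Z : ∀ e i → ρ e i ≤ Z
        ρ≤Z e i = ≤-trans (proj₂ (upperBound (ρ e)) i) (≤-trans (proj₂ upper e) (proj₁ (proj₂ both)))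
        -ρ≤Z : ∀ e i → - ρ e i ≤ Z
        -ρ≤Z e i = ≤-trans (proj₂ (upperBound (λ i → - ρ e i)) i) (≤-trans (proj₂ lower e) (proj₂ (proj₂ both)))
        K : ℕ
        K = proj₁ (ℕ-upperBound k)
        unbounded : ∀ m → Z ≤ ι m → ⊥
        unbounded m Z≤ιm = bounded⇒⊥ {K ℕ.+ m}
          (λ i → ℕ.≤-trans (proj₂ (ℕ-upperBound k) i) (ℕ.m≤m+n K m))
          (λ e i → ≤-trans (ρ≤Z e i) Z≤ι)
          (λ e i → ≤-respˡ-≈ (-‿inverseˡ (ρ e i)) (+-monoˡ-≤ (ρ e i) (≤-trans (-ρ≤Z e i) Z≤ι)))
          where
          Z≤ι : Z ≤ ι (K ℕ.+ m)
          Z≤ι = ≤-respʳ-≈ (≈-sym (ι-+ K m)) (≤-trans Z≤ιm (x≤y+x (ι m) (ι-nonneg K)))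

-- Records: height estimates and congruences modulo `2Λ`.

∣i+i∣≡∣i∣+∣i∣ : ∀ i → ℤ.∣ i ℤ.+ i ∣ ≡ ℤ.∣ i ∣ ℕ.+ ℤ.∣ i ∣
∣i+i∣≡∣i∣+∣i∣ (+ n)         = ≡.refl
∣i+i∣≡∣i∣+∣i∣ (ℤ.-[1+ n ]) = ≡.cong suc (≡.sym (ℕ.+-suc n n))

m+m<n+n⇒m<n : ∀ {m n} → m ℕ.+ m ℕ.< n ℕ.+ n → m ℕ.< n
m+m<n+n⇒m<n lt = ℕ.≰⇒> λ n≤m → ℕ.<⇒≱ lt (ℕ.+-mono-≤ n≤m n≤m)

∣difference∣< : ∀ {m n o} i → + m ≡ + n ℤ.+ i → m ℕ.< n ℕ.+ o → n ℕ.< m ℕ.+ o → ℤ.∣ i ∣ ℕ.< o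
∣difference∣< {n = n} (+ k) eq m<n+o _ =
  ℕ.+-cancelˡ-< n _ _ (≡.subst (ℕ._< _) (ℤ.+-injective eq) m<n+o)
∣difference∣< {m} {n} (ℤ.-[1+ k ]) eq _ n<m+o =
  ℕ.+-cancelˡ-< m _ _ (≡.subst (ℕ._< _) (≡.sym (ℤ.+-injective moved)) n<m+o)
  where
  moved : + (m ℕ.+ suc k) ≡ + n
  moved = ≡.trans (≡.cong (ℤ._+ + suc k) eq)
    (≡.trans (ℤ.+-assoc (+ n) ℤ.-[1+ k ] (+ suc k))
    (≡.trans (≡.cong (λ i → + n ℤ.+ i) (ℤ.+-inverseˡ (+ suc k))) (ℤ.+-identityʳ (+ n))))

∣half-difference∣< : ∀ {m n o} i → + m ≡ + n ℤ.+ (i ℤ.+ i) →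
                     m ℕ.< n ℕ.+ (o ℕ.+ o) → n ℕ.< m ℕ.+ (o ℕ.+ o) → ℤ.∣ i ∣ ℕ.< o
∣half-difference∣< i eq m< n< = m+m<n+n⇒m<n
  (≡.subst (ℕ._< _) (∣i+i∣≡∣i∣+∣i∣ i) (∣difference∣< (i ℤ.+ i) eq m< n<))

module Records {c ℓ v ℓv : Level} {ℝ : CompleteOrderedField c ℓ} (V : InnerProductSpace ℝ v ℓv) where
  open CompleteOrderedField ℝ hiding (zero)
  open InnerProductSpace V
  open Ordered ℝ
  open Space V
  open Mod2 ℤ×V
  open Cosets V
  open Relation.Binary.Reasoning.PartialOrder poset
  open Relation.Binary.Properties.DecTotalOrder decTotalOrder using (≰⇒≥)
  open ℝ-Solver using (solve; _:=_; _:+_)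

  module _ {p} {Λ : Pred ℤ×V.Carrier p} (sub : IsSubgroup Λ) where
    open IsSubgroup sub

    infix 4 _≡₂_
    _≡₂_ : ℤ×V.Carrier → ℤ×V.Carrier → Set _
    _≡₂_ = _≈₂_ sub

    record IsRecord (a : ℕ) (x : Carrierᴹ) : Set (ℓ ⊔ v ⊔ ℓv ⊔ p) where
      field
        member  : (+ a , x) ∈ Λ
        nonzero : x ≉ᴹ 0ᴹ
        minimal : ∀ {k y} → (k , y) ∈ Λ → y ≉ᴹ 0ᴹ → ℤ.∣ k ∣ ℕ.< a → ¬ q y ≤ q x

    open IsRecord

    decreasing : ∀ {a b x y} → IsRecord a x → IsRecord b y → a ℕ.< b → ¬ q x ≤ q y
    decreasing X Y a<b = minimal Y (member X) (nonzero X) a<b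

    -- A half `u` of the record would have height below `a` in absolute value and
    -- `q u ≤ 4 q u = q x`.
    record-indivisible : ∀ {a x} → 0 ℕ.< a → IsRecord a x → ¬ (+ a , x) ≡₂ ℤ×V.ε
    record-indivisible {a} {x} 0<a X ((κ , u) , u∈ , aeq , x≈) =
      minimal X u∈ u≉0 (∣half-difference∣< κ aeq (ℕ.m<m+n a 0<a) (ℕ.<-≤-trans 0<a (ℕ.m≤m+n a _))) (begin
        q u                        ≤⟨ x≤x+y (q u) (⟨⟩-nonneg u) ⟩
        q u + q u                  ≤⟨ x≤x+y _ (+-nonneg (⟨⟩-nonneg u) (⟨⟩-nonneg u)) ⟩
        (q u + q u) + (q u + q u)  ≈⟨ q-double u ⟨
        q (u +ᴹ u)                 ≈⟨ q-cong x≈2u ⟨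
        q x                        ∎)
      where
      x≈2u : x ≈ᴹ u +ᴹ u
      x≈2u = ≈ᴹ-trans x≈ (+ᴹ-identityˡ _)
      u≉0 : u ≉ᴹ 0ᴹ
      u≉0 u≈0 = nonzero X (≈ᴹ-trans x≈2u (≈ᴹ-trans (+ᴹ-cong u≈0 u≈0) (+ᴹ-identityˡ 0ᴹ)))

    -- If `y = x + 2u`, then `u` is low enough to compete with `x`, so `q x ≤ q u`. The
    -- parallelogram law `q y + q x = 2 q (x + u) + 2 q u` gives `q x ≤ q y`, but the higher record
    -- is shorter.
    records-incongruent : ∀ {a b x y} → a ℕ.< b → b ℕ.< a ℕ.+ a → IsRecord a x → IsRecord b y →
                          ¬ (+ b , y) ≡₂ (+ a , x)
    records-incongruent {a} {b} {x} {y} a<b b<2a X Y ((κ , u) , u∈ , beq , y≈) =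
      contra (total (q u) (q x))
      where
      -- Otherwise `x` and `y` would be equally long records at different heights.
      u≉0 : u ≉ᴹ 0ᴹ
      u≉0 u≈0 = decreasing X Y a<b (≤-reflexive (q-cong (≈ᴹ-sym (≈ᴹ-trans y≈
        (≈ᴹ-trans (+ᴹ-congˡ (≈ᴹ-trans (+ᴹ-cong u≈0 u≈0) (+ᴹ-identityˡ 0ᴹ))) (+ᴹ-identityʳ x))))))
      qu≰qx : ¬ q u ≤ q x
      qu≰qx = minimal X u∈ u≉0 (∣half-difference∣< κ beq
        (ℕ.<-≤-trans b<2a (ℕ.m≤n+m _ a)) (ℕ.<-≤-trans a<b (ℕ.m≤m+n b _)))
      contra : _ → ⊥
      contra (inj₁ le) = qu≰qx le
      contra (inj₂ qx≤qu) = decreasing X Y a<b (+-cancelʳ-≤ (q x) (begin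
        q x + q x                                         ≤⟨ +-mono-≤ qx≤qu qx≤qu ⟩
        q u + q u                                         ≤⟨ x≤y+x _ (+-nonneg (⟨⟩-nonneg _) (⟨⟩-nonneg _)) ⟩
        (q (x +ᴹ u) + q (x +ᴹ u)) + (q u + q u)           ≈⟨ parallelogram x u ⟨
        q (x +ᴹ (u +ᴹ u)) + q x                           ≈⟨ +-congʳ (q-cong y≈) ⟨
        q y + q x                                         ∎))

    -- Excludes `t`, `u` or `v` vanishing in `records-sum-free`: one of the three vectors would then
    -- be the sum of the other two, and a difference of two records, at height below that of `x`,
    -- would be no longer than `x`.
    minimal-difference : ∀ {a x m n y y′ z} → IsRecord a x → (+ m , y) ∈ Λ → (+ n , y′) ∈ Λ →
      y ≈ᴹ y′ +ᴹ z → z ≉ᴹ 0ᴹ → m ℕ.< n ℕ.+ a → n ℕ.< m ℕ.+ a → ¬ q z ≤ q x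
    minimal-difference {m = m} {n} {y} {y′} {z} X y∈ y′∈ y≈ z≉0 m< n< = minimal X
      (∈-resp-≈ (≡.refl , ≈ᴹ-trans (+ᴹ-congʳ y≈) (V-Group.xyx⁻¹≈y y′ z)) (∙∈ y∈ (⁻¹∈ y′∈))) z≉0
      (∣difference∣< (+ m ℤ.- + n)
        (≡.sym (≡.trans (≡.cong (λ i → + n ℤ.+ i) (ℤ.+-comm (+ m) (ℤ.- + n)))
          (≡.trans (≡.sym (ℤ.+-assoc (+ n) (ℤ.- + n) (+ m)))
          (≡.trans (≡.cong (ℤ._+ + m) (ℤ.+-inverseʳ (+ n))) (ℤ.+-identityˡ (+ m)))))) m< n<)

    -- t, u, v are (y + z − x)/2, (x + z − y)/2, (x + y − z)/2.  Their heights are small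
    -- enough for q y ≤ q t and q x ≤ q u, q v, which q z < q x and the hexagon
    -- inequality exclude.
    records-sum-free : ∀ {i l j x y z t u v} → i ℕ.< l → l ℕ.< j → j ℕ.< i ℕ.+ l → l ℕ.< i ℕ.+ i → j ℕ.< l ℕ.+ i →
      IsRecord i x → IsRecord l y → IsRecord j z → t ∈ Λ → u ∈ Λ → v ∈ Λ →
      (+ i , x) ℤ×V.≈ u ℤ×V.∙ v → (+ l , y) ℤ×V.≈ t ℤ×V.∙ v → (+ j , z) ℤ×V.≈ t ℤ×V.∙ u → ⊥
    records-sum-free {i} {l} {j} {x} {y} {z} {tk , t} {uk , u} {vk , v} i<l l<j j<i+l l<i+i j<l+i X Y Z t∈ u∈ v∈
      (ieq , x≈) (leq , y≈) (jeq , z≈) = decreasing X Z (ℕ.<-trans i<l l<j)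
        (+-cancelˡ-≤ (q x + q y) (begin
          (q x + q y) + q x     ≈⟨ solve 2 (λ x y → (x :+ y) :+ x := y :+ x :+ x) ≈-refl (q x) (q y) ⟩
          q y + q x + q x       ≤⟨ +-mono-≤ (+-mono-≤ qy≤qt qx≤qu) qx≤qv ⟩
          q t + q u + q v       ≤⟨ hexagon t u v ⟩
          q (u +ᴹ v) + q (t +ᴹ v) + q (t +ᴹ u)
            ≈⟨ +-cong (+-cong (q-cong x≈) (q-cong y≈)) (q-cong z≈) ⟨
          q x + q y + q z       ∎))
      where
      open V-Solver using (_⊕_; _⊜_)
      drop : ∀ {r s s′ t} → t ≈ᴹ 0ᴹ → r ≈ᴹ s +ᴹ (t +ᴹ t) → s ≈ᴹ s′ → r ≈ᴹ s′
      drop t≈0 r≈ s≈ = ≈ᴹ-trans r≈ (≈ᴹ-trans (+ᴹ-cong s≈ (≈ᴹ-trans (+ᴹ-cong t≈0 t≈0) (+ᴹ-identityˡ 0ᴹ))) (+ᴹ-identityʳ _))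
      t≉0 : t ≉ᴹ 0ᴹ
      t≉0 t≈0 = minimal-difference X (member X) (member Y) (≈ᴹ-sym (drop t≈0
          (≈ᴹ-trans (+ᴹ-cong y≈ z≈) (V-Solver.solve 3 (λ t u v → (t ⊕ v) ⊕ (t ⊕ u) ⊜ (u ⊕ v) ⊕ (t ⊕ t)) ≈ᴹ-refl t u v))
          (≈ᴹ-sym x≈))) (nonzero Z)
        (ℕ.<-≤-trans i<l (ℕ.m≤m+n l i)) l<i+i
        (≰⇒≥ (decreasing X Z (ℕ.<-trans i<l l<j)))
      u≉0 : u ≉ᴹ 0ᴹ
      u≉0 u≈0 = minimal-difference X (member Y) (member Z) (≈ᴹ-sym (drop u≈0
          (≈ᴹ-trans (+ᴹ-cong z≈ x≈) (V-Solver.solve 3 (λ t u v → (t ⊕ u) ⊕ (u ⊕ v) ⊜ (t ⊕ v) ⊕ (u ⊕ u)) ≈ᴹ-refl t u v))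
          (≈ᴹ-sym y≈))) (nonzero X)
        (ℕ.<-≤-trans l<j (ℕ.m≤m+n j i)) j<l+i ≤-refl
      v≉0 : v ≉ᴹ 0ᴹ
      v≉0 v≈0 = minimal-difference X (member Z) (member Y) (≈ᴹ-sym (drop v≈0
          (≈ᴹ-trans (+ᴹ-cong y≈ x≈) (V-Solver.solve 3 (λ t u v → (t ⊕ v) ⊕ (u ⊕ v) ⊜ (t ⊕ u) ⊕ (v ⊕ v)) ≈ᴹ-refl t u v))
          (≈ᴹ-sym z≈))) (nonzero X)
        j<l+i (ℕ.<-≤-trans l<j (ℕ.m≤m+n j i)) ≤-refl
      open ℤ-Solver using () renaming (solve to ℤ-solve; _:+_ to _:+ℤ_; _:=_ to _:=ℤ_)
      -- The three estimates: `2 tk = l + j - i < 2 l`, `2 uk = i + j - l < 2 i` and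
      -- `2 vk = i + l - j < 2 i`.
      ∣tk∣<l : ℤ.∣ tk ∣ ℕ.< l
      ∣tk∣<l = ∣half-difference∣< {l ℕ.+ j} {i} tk
        (≡.trans (≡.cong₂ ℤ._+_ leq jeq) (≡.trans
          (ℤ-solve 3 (λ t u v → (t :+ℤ v) :+ℤ (t :+ℤ u) :=ℤ (u :+ℤ v) :+ℤ (t :+ℤ t)) ≡.refl tk uk vk)
          (≡.cong (ℤ._+ (tk ℤ.+ tk)) (≡.sym ieq))))
        (≡.subst (l ℕ.+ j ℕ.<_) (≡.trans (ℕ.+-comm l _) (ℕ.+-assoc i l l)) (ℕ.+-monoʳ-< l j<i+l))
        (ℕ.<-≤-trans i<l (ℕ.m≤n⇒m≤n+o _ (ℕ.m≤m+n l j)))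
      ∣uk∣<i : ℤ.∣ uk ∣ ℕ.< i
      ∣uk∣<i = ∣half-difference∣< {i ℕ.+ j} {l} uk
        (≡.trans (≡.cong₂ ℤ._+_ ieq jeq) (≡.trans
          (ℤ-solve 3 (λ t u v → (u :+ℤ v) :+ℤ (t :+ℤ u) :=ℤ (t :+ℤ v) :+ℤ (u :+ℤ u)) ≡.refl tk uk vk)
          (≡.cong (ℤ._+ (uk ℤ.+ uk)) (≡.sym leq))))
        (≡.subst (i ℕ.+ j ℕ.<_) (≡.trans (ℕ.+-comm i _) (ℕ.+-assoc l i i)) (ℕ.+-monoʳ-< i j<l+i))
        (ℕ.<-≤-trans l<j (ℕ.m≤n⇒m≤n+o _ (ℕ.m≤n+m j i)))
      ∣vk∣<i : ℤ.∣ vk ∣ ℕ.< i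
      ∣vk∣<i = ∣half-difference∣< {i ℕ.+ l} {j} vk
        (≡.trans (≡.cong₂ ℤ._+_ ieq leq) (≡.trans
          (ℤ-solve 3 (λ t u v → (u :+ℤ v) :+ℤ (t :+ℤ v) :=ℤ (t :+ℤ u) :+ℤ (v :+ℤ v)) ≡.refl tk uk vk)
          (≡.cong (ℤ._+ (vk ℤ.+ vk)) (≡.sym jeq))))
        (ℕ.<-≤-trans (≡.subst (ℕ._< j ℕ.+ i) (ℕ.+-comm l i) (ℕ.+-monoˡ-< i l<j)) (ℕ.+-monoʳ-≤ j (ℕ.m≤m+n i i)))
        (ℕ.<-≤-trans j<i+l (ℕ.m≤m+n _ _))
      qy≤qt : q y ≤ q t
      qy≤qt = ≰⇒≥ (minimal Y t∈ t≉0 ∣tk∣<l)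
      qx≤qu : q x ≤ q u
      qx≤qu = ≰⇒≥ (minimal X u∈ u≉0 ∣uk∣<i)
      qx≤qv : q x ≤ q v
      qx≤qv = ≰⇒≥ (minimal X v∈ v≉0 ∣vk∣<i)

    module _ {d} {b : Fin d → Carrierᴹ} (span : ∀ y → ∃ λ r → y ≈ᴹ linearCombination r b)
             {ε : Carrier} (0≤ε : 0# ≤ ε) (ε≉0 : ε ≉ 0#)
             (separated : ∀ {y} → (+ 0 , y) ∈ Λ → ¬ ε ≤ q y → y ≈ᴹ 0ᴹ) where

      -- More than `2 ^ d` records would give, by `Doubling`, more than `2 ^ (1 + d)` incongruent
      -- points. Doubling with the highest record `c` makes the forbidden relations exactly those
      -- that `records-sum-free` treats, with `c` as its third record.
      record-count : ∀ {m} (c : Fin m) {a : Fin m → ℕ} {x : Fin m → Carrierᴹ} →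
        (∀ i → IsRecord (a i) (x i)) → (∀ {i j} → i ≢ j → a i ≢ a j) → (∀ i j k → a i ℕ.< a j ℕ.+ a k) →
        (∀ {i} → i ≢ c → a i ℕ.< a c) → m ℕ.≤ 2 ℕ.^ d
      record-count {m} c {a} {x} rec injective spread largest = ℕ.≮⇒≥ λ 2^d<m →
        too-many-cosets span sub 0≤ε ε≉0 separated
          (≡.subst (ℕ._< m ℕ.+ m) (≡.cong (λ n → 2 ℕ.^ d ℕ.+ n) (≡.sym (ℕ.+-identityʳ _))) (ℕ.+-mono-< 2^d<m 2^d<m))
          doubled∈ doubled-height doubled-incongruent
        where
        w : Fin m → ℤ×V.Carrier
        w i = + a i , x i

        positive : ∀ i → 0 ℕ.< a i
        positive i = ℕ.+-cancelˡ-< (a i) 0 (a i) (≡.subst (ℕ._< a i ℕ.+ a i) (≡.sym (ℕ.+-identityʳ (a i))) (spread i i i))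

        incongruent : ∀ {i j} → i ≢ j → ¬ w i ≡₂ w j
        incongruent {i} {j} i≢j cong with ℕ.<-cmp (a i) (a j)
        ... | tri< i<j _ _ = records-incongruent i<j (spread j i i) (rec i) (rec j) (≈₂-sym sub cong)
        ... | tri≈ _ i≡j _ = injective i≢j i≡j
        ... | tri> _ _ j<i = records-incongruent j<i (spread i j j) (rec j) (rec i) cong

        sum-free : ∀ {i j} → i ≢ j → i ≢ c → j ≢ c → ¬ w i ≡₂ w j ℤ×V.∙ w c
        sum-free {i} {j} i≢j i≢c j≢c cong
          with midpoints sub (member (rec j)) (member (rec c)) cong | ℕ.<-cmp (a i) (a j)
        ... | r , s , t , r∈ , s∈ , t∈ , i≈ , j≈ , c≈ | tri< i<j _ _ =
          records-sum-free i<j (largest j≢c) (spread c i j) (spread j i i) (spread c j i)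
            (rec i) (rec j) (rec c) r∈ s∈ t∈ i≈ j≈ c≈
        ... | _ | tri≈ _ i≡j _ = injective i≢j i≡j
        -- Exchanging `i` and `j` exchanges `r` and `s`.
        ... | r , s , t , r∈ , s∈ , t∈ , i≈ , j≈ , c≈ | tri> _ _ j<i =
          records-sum-free j<i (largest i≢c) (spread c j i) (spread i j j) (spread c i j)
            (rec j) (rec i) (rec c) s∈ r∈ t∈ j≈ i≈ (ℤ×V.trans c≈ (ℤ×V.comm r s))

        open Doubling sub w c (λ i → member (rec i)) (λ i → record-indivisible (positive i) (rec i)) incongruent sum-free

        doubled-height : ∀ i → proj₁ (doubled i) ≡ + ℤ.∣ proj₁ (doubled i) ∣
        doubled-height i with splitAt m i
        ... | inj₁ j = ≡.refl
        ... | inj₂ j = ≡.refl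

-- Distinct values of a finite sequence and its jumps.

AllPairs-lookup : ∀ {a r} {A : Set a} {R : A → A → Set r} {xs : List A} → AllPairs R xs →
                  ∀ {i j} → i Fin.< j → R (lookup xs i) (lookup xs j)
AllPairs-lookup (Rx ∷ _)  {zero}  {suc j} _ = All.lookup Rx (∈-lookup j)
AllPairs-lookup (_ ∷ Rxs) {suc i} {suc j} (ℕ.s≤s i<j) = AllPairs-lookup Rxs i<j

module Values {c ℓ : Level} (ℝ : CompleteOrderedField c ℓ) where
  open CompleteOrderedField ℝ hiding (zero)

  -- Pigeonhole on positions in `ys`: two entries sent to one position would be equal, against
  -- deduplication.
  deduplicate-length : ∀ {xs} ys → All (λ x → Any (x ≈_) ys) xs → length (deduplicate _≟_ xs) ℕ.≤ length ys
  deduplicate-length {xs} ys xs⊆ys = ℕ.≮⇒≥ λ fewer →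
    let i , j , i<j , eq = Fin.pigeonhole fewer position in
    AllPairs-lookup distinct i<j (≈-trans (at i) (≈-trans (≈-reflexive (≡.cong (lookup ys) eq)) (≈-sym (at j))))
    where
    distinct = Data.List.Relation.Unary.Unique.DecSetoid.Properties.deduplicate-! (DecTotalOrder.Eq.decSetoid decTotalOrder) xs
    covered : ∀ i → Any (lookup (deduplicate _≟_ xs) i ≈_) ys
    covered i = All.lookup (All.deduplicate⁺ _≟_ xs⊆ys) (∈-lookup i)
    position : Fin (length (deduplicate _≟_ xs)) → Fin (length ys)
    position i = Any.index (covered i)
    at : ∀ i → lookup (deduplicate _≟_ xs) i ≈ lookup ys (position i)
    at i = lookup-index (covered i)

  module Jumps (g : ℕ → Carrier) where
    -- The latest jump comes first, so that index `zero` can serve as the highest record in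
    -- `record-count`.
    jumps : ℕ → List ℕ
    jumps zero = []
    jumps (suc j) with g j ≟ g (suc j)
    ... | yes _ = jumps j
    ... | no  _ = j ∷ jumps j

    jumps-< : ∀ j → All (ℕ._< j) (jumps j)
    jumps-< zero = []
    jumps-< (suc j) with g j ≟ g (suc j)
    ... | yes _ = All.map ℕ.m<n⇒m<1+n (jumps-< j)
    ... | no  _ = ℕ.n<1+n j ∷ All.map ℕ.m<n⇒m<1+n (jumps-< j)

    jumps-≉ : ∀ j → All (λ i → g i ≉ g (suc i)) (jumps j)
    jumps-≉ zero = []
    jumps-≉ (suc j) with g j ≟ g (suc j)
    ... | yes _ = jumps-≉ j
    ... | no neq = neq ∷ jumps-≉ j

    jumps-decreasing : ∀ j → AllPairs ℕ._>_ (jumps j)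
    jumps-decreasing zero = []
    jumps-decreasing (suc j) with g j ≟ g (suc j)
    ... | yes _ = jumps-decreasing j
    ... | no  _ = jumps-< j ∷ jumps-decreasing j

    -- The entry `g 0` accounts for the summand 1 in the final bound.
    values : ℕ → List Carrier
    values j = g 0 ∷ map (λ i → g (suc i)) (jumps j)

    last-value : ∀ j → Any (g j ≈_) (values j)
    last-value zero = here ≈-refl
    last-value (suc j) with g j ≟ g (suc j)
    ... | yes eq = Any.map (≈-trans (≈-sym eq)) (last-value j)
    ... | no  _ = there (here ≈-refl)

    values-grow : ∀ {x} j → Any (x ≈_) (values j) → Any (x ≈_) (values (suc j))
    values-grow j x∈ with g j ≟ g (suc j) | x∈
    ... | yes _ | _         = x∈
    ... | no  _ | here eq   = here eq
    ... | no  _ | there x∈′ = there (there x∈′)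

    all-values : ∀ {i j} → i ℕ.≤′ j → Any (g i ≈_) (values j)
    all-values {i} ℕ.≤′-refl            = last-value i
    all-values     (ℕ.≤′-step {j} i≤′j) = values-grow j (all-values i≤′j)

-- From minimal distances to records.

module Gaps {c ℓ v ℓv : Level} {ℝ : CompleteOrderedField c ℓ} (V : InnerProductSpace ℝ v ℓv) where
  open CompleteOrderedField ℝ hiding (zero)
  open InnerProductSpace V
  open Ordered ℝ
  open Space V
  open Mod2 ℤ×V
  open Records V
  open Relation.Binary.Reasoning.PartialOrder poset
  open Relation.Binary.Properties.DecTotalOrder decTotalOrder using (≰⇒≥; ≰⇒>)
  open Algebra.Properties.Monoid.Mult +ᴹ-monoid using (×-homo-+)
  open V-Solver using (_⊕_; _⊜_)
  module ℝ-Group = Algebra.Properties.Ring ring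

  ‖‖-nonneg : ∀ x → 0# ≤ ‖ x ‖
  ‖‖-nonneg x = proj₁ (proj₂ (SquareRoot.sqrt ℝ (q x) (⟨⟩-nonneg x)))

  ‖‖-square : ∀ x → ‖ x ‖ * ‖ x ‖ ≈ q x
  ‖‖-square x = proj₂ (proj₂ (SquareRoot.sqrt ℝ (q x) (⟨⟩-nonneg x)))

  ‖‖-mono : ∀ {x y} → q x ≤ q y → ‖ x ‖ ≤ ‖ y ‖
  ‖‖-mono {x} {y} le = square-cancel-≤ (‖‖-nonneg y)
    (≤-respˡ-≈ (≈-sym (‖‖-square x)) (≤-respʳ-≈ (≈-sym (‖‖-square y)) le))

  ‖‖-cong : ∀ {x y} → q x ≈ q y → ‖ x ‖ ≈ ‖ y ‖
  ‖‖-cong eq = antisym (‖‖-mono (≤-reflexive eq)) (‖‖-mono (≤-reflexive (≈-sym eq)))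

  ⟨⟩-0 : ∀ y → ⟨ 0ᴹ , y ⟩ ≈ 0#
  ⟨⟩-0 y = ≈-trans (⟨⟩-cong (≈ᴹ-sym (*ₗ-zeroˡ 0ᴹ)) ≈ᴹ-refl) (≈-trans (⟨⟩-* 0# 0ᴹ y) (zeroˡ _))

  ⟨⟩-neg : ∀ x y → ⟨ -ᴹ x , y ⟩ ≈ - ⟨ x , y ⟩
  ⟨⟩-neg x y = ℝ-Group.+-inverseˡ-unique _ _ (begin-equality
    ⟨ -ᴹ x , y ⟩ + ⟨ x , y ⟩  ≈⟨ ⟨⟩-+ (-ᴹ x) x y ⟨
    ⟨ -ᴹ x +ᴹ x , y ⟩         ≈⟨ ⟨⟩-cong (-ᴹ‿inverseˡ x) ≈ᴹ-refl ⟩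
    ⟨ 0ᴹ , y ⟩                ≈⟨ ⟨⟩-0 y ⟩
    0#                        ∎)

  q-neg : ∀ x → q (-ᴹ x) ≈ q x
  q-neg x = begin-equality
    ⟨ -ᴹ x , -ᴹ x ⟩  ≈⟨ ⟨⟩-neg x (-ᴹ x) ⟩
    - ⟨ x , -ᴹ x ⟩   ≈⟨ -‿cong (≈-trans (⟨⟩-sym x (-ᴹ x)) (⟨⟩-neg x x)) ⟩
    - - ⟨ x , x ⟩    ≈⟨ ℝ-Group.-‿involutive _ ⟩
    ⟨ x , x ⟩        ∎

  ·-neg : ∀ k α → (ℤ.- k) · α ≈ᴹ -ᴹ (k · α)
  ·-neg (+ zero)      α = ≈ᴹ-sym V-Group.ε⁻¹≈ε
  ·-neg (+ suc n)     α = ≈ᴹ-refl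
  ·-neg (ℤ.-[1+ n ])  α = ≈ᴹ-sym (V-Group.⁻¹-involutive _)

  ·-⊖ : ∀ m n α → (m ℤ.⊖ n) · α ≈ᴹ m ×ᴹ α -ᴹ n ×ᴹ α
  ·-⊖ zero    zero    α = ≈ᴹ-sym (-ᴹ‿inverseʳ 0ᴹ)
  ·-⊖ zero    (suc n) α = ≈ᴹ-sym (+ᴹ-identityˡ _)
  ·-⊖ (suc m) zero    α = ≈ᴹ-sym (≈ᴹ-trans (+ᴹ-congˡ V-Group.ε⁻¹≈ε) (+ᴹ-identityʳ _))
  ·-⊖ (suc m) (suc n) α rewrite ℤ.[1+m]⊖[1+n]≡m⊖n m n = ≈ᴹ-trans (·-⊖ m n α) (≈ᴹ-sym
    (≈ᴹ-trans (+ᴹ-congˡ (≈ᴹ-sym (V-Group.⁻¹-∙-comm α (n ×ᴹ α))))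
    (≈ᴹ-trans (V-Solver.solve 4 (λ x y z w → (x ⊕ y) ⊕ (z ⊕ w) ⊜ (x ⊕ z) ⊕ (y ⊕ w)) ≈ᴹ-refl α (m ×ᴹ α) (-ᴹ α) (-ᴹ (n ×ᴹ α)))
    (≈ᴹ-trans (+ᴹ-congʳ (-ᴹ‿inverseʳ α)) (+ᴹ-identityˡ _)))))

  ·-+ : ∀ j k α → (j ℤ.+ k) · α ≈ᴹ j · α +ᴹ k · α
  ·-+ (+ m)        (+ n)        α = ×-homo-+ α m n
  ·-+ (+ m)        (ℤ.-[1+ n ]) α = ·-⊖ m (suc n) α
  ·-+ (ℤ.-[1+ m ]) (+ n)        α = ≈ᴹ-trans (·-⊖ n (suc m) α) (+ᴹ-comm _ _)
  ·-+ (ℤ.-[1+ m ]) (ℤ.-[1+ n ]) α = ≈ᴹ-trans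
    (≡.subst (λ k → -ᴹ (suc (suc (m ℕ.+ n)) ×ᴹ α) ≈ᴹ -ᴹ (suc k ×ᴹ α)) (≡.sym (ℕ.+-suc m n)) ≈ᴹ-refl)
    (≈ᴹ-trans (-ᴹ‿cong (×-homo-+ α (suc m) (suc n))) (≈ᴹ-sym (V-Group.⁻¹-∙-comm _ _)))

  module _ {p} {L : Pred Carrierᴹ p} (lattice : IsFullRankLattice L) (α : Carrierᴹ) where
    open IsFullRankLattice lattice

    Λ : Pred ℤ×V.Carrier _
    Λ (k , x) = ∃ λ l → l ∈ L × x ≈ᴹ k · α +ᴹ l

    Λ-isSubgroup : IsSubgroup Λ
    Λ-isSubgroup = record
      { ∈-resp-≈ = λ { (≡.refl , x≈) (l , l∈ , eq) → l , l∈ , ≈ᴹ-trans (≈ᴹ-sym x≈) eq }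
      ; ε∈       = 0ᴹ , 0∈ , ≈ᴹ-sym (+ᴹ-identityˡ 0ᴹ)
      ; ∙∈       = λ { {j , _} {k , _} (l , l∈ , eq) (l′ , l′∈ , eq′) → l +ᴹ l′ , +∈ l∈ l′∈ ,
          ≈ᴹ-trans (+ᴹ-cong eq eq′) (≈ᴹ-trans
            (V-Solver.solve 4 (λ x y z w → (x ⊕ y) ⊕ (z ⊕ w) ⊜ (x ⊕ z) ⊕ (y ⊕ w)) ≈ᴹ-refl (j · α) l (k · α) l′)
            (+ᴹ-congʳ (≈ᴹ-sym (·-+ j k α)))) }
      ; ⁻¹∈      = λ { {k , _} (l , l∈ , eq) → -ᴹ l , -∈ l∈ ,
          ≈ᴹ-trans (-ᴹ‿cong eq) (≈ᴹ-trans (≈ᴹ-sym (V-Group.⁻¹-∙-comm _ _)) (+ᴹ-congʳ (≈ᴹ-sym (·-neg k α)))) }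
      }
    open IsSubgroup Λ-isSubgroup using () renaming (∈-resp-≈ to Λ-resp-≈)

    Λ-neg : ∀ k {x} → (k , x) ∈ Λ → (ℤ.- k , -ᴹ x) ∈ Λ
    Λ-neg k {x} = IsSubgroup.⁻¹∈ Λ-isSubgroup {k , x}

    -- Height 0 of `Λ` is `L`, so discreteness at the origin with radius `ε` separates squared norms
    -- by `ε * ε`.
    Λ-separated : ∃ λ ε → 0# ≤ ε × ε ≉ 0# × (∀ {y} → (+ 0 , y) ∈ Λ → ¬ ε ≤ q y → y ≈ᴹ 0ᴹ)
    Λ-separated with discrete 0ᴹ 0∈
    ... | ε , (0≤ε , 0≉ε) , isolated = ε * ε , *-nonneg 0≤ε 0≤ε , (λ εε≈0 → 0≉ε (≈-sym (square≈0⇒≈0 εε≈0))) , sep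
      where
      sep : ∀ {y} → (+ 0 , y) ∈ Λ → ¬ ε * ε ≤ q y → y ≈ᴹ 0ᴹ
      sep {y} (l , l∈ , y≈) εε≰ = isolated y (∈-resp-≈ (≈ᴹ-sym (≈ᴹ-trans y≈ (+ᴹ-identityˡ l))) l∈)
        (≰⇒> λ ε≤ → εε≰ (begin
          ε * ε                    ≤⟨ *-mono-≤ 0≤ε (‖‖-nonneg _) ε≤ ε≤ ⟩
          ‖ y -ᴹ 0ᴹ ‖ * ‖ y -ᴹ 0ᴹ ‖  ≈⟨ ‖‖-square _ ⟩
          q (y -ᴹ 0ᴹ)              ≈⟨ q-cong (≈ᴹ-trans (+ᴹ-congˡ V-Group.ε⁻¹≈ε) (+ᴹ-identityʳ y)) ⟩
          q y                      ∎))

    neg-nonzero : ∀ {x} → x ≉ᴹ 0ᴹ → -ᴹ x ≉ᴹ 0ᴹ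
    neg-nonzero x≉0 -x≈0 = x≉0 (V-Group.⁻¹-injective (≈ᴹ-trans -x≈0 (≈ᴹ-sym V-Group.ε⁻¹≈ε)))

    module _ {N : ℕ} {δ : ℕ → Carrier} (isMin : IsMinimalDistance V L α N δ) where

      δ-attained : ∀ {n} → 1 ℕ.≤ n → n ℕ.≤ N → ∃ λ m → ∃ λ x →
        1 ℕ.≤ m × m ℕ.≤ N × (+ m ℤ.- + n , x) ∈ Λ × x ≉ᴹ 0ᴹ × δ n ≈ ‖ x ‖
      δ-attained {n} 1≤n n≤N with proj₁ (isMin n 1≤n n≤N)
      ... | + m , l , 1≤m , m≤N , l∈ , x≉0 , δ≈ =
        m , _ , ℤ.drop‿+≤+ 1≤m , ℤ.drop‿+≤+ m≤N , (l , l∈ , ≈ᴹ-refl) , x≉0 , δ≈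

      δ-lower : ∀ {n m x} → 1 ℕ.≤ n → n ℕ.≤ N → 1 ℕ.≤ m → m ℕ.≤ N →
                (+ m ℤ.- + n , x) ∈ Λ → x ≉ᴹ 0ᴹ → δ n ≤ ‖ x ‖
      δ-lower {n} {m} {x} 1≤n n≤N 1≤m m≤N (l , l∈ , x≈) x≉0 = proj₂ (isMin n 1≤n n≤N) ‖ x ‖
        (+ m , l , ℤ.+≤+ 1≤m , ℤ.+≤+ m≤N , l∈ , (λ ≈0 → x≉0 (≈ᴹ-trans x≈ ≈0)) , ‖‖-cong (q-cong x≈))

      -- Sending `m` to `N + 1 - m` and `x` to `- x` turns competitors for `n` into competitors for
      -- `n′`.
      δ-reflect-≤ : ∀ {n n′} → 1 ℕ.≤ n → n ℕ.≤ N → 1 ℕ.≤ n′ → n′ ℕ.≤ N → n ℕ.+ n′ ≡ suc N → δ n′ ≤ δ n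
      δ-reflect-≤ {n} {n′} 1≤n n≤N 1≤n′ n′≤N n+n′≡ with δ-attained 1≤n n≤N
      ... | m , x , 1≤m , m≤N , x∈ , x≉0 , δ≈ = begin
        δ n′        ≤⟨ δ-lower 1≤n′ n′≤N (ℕ.m<n⇒0<n∸m (ℕ.s≤s m≤N)) (ℕ.∸-monoʳ-≤ (suc N) 1≤m)
                         (Λ-resp-≈ (reflected , ≈ᴹ-refl) (Λ-neg (+ m ℤ.- + n) x∈)) (neg-nonzero x≉0) ⟩
        ‖ -ᴹ x ‖    ≈⟨ ‖‖-cong (q-neg x) ⟩
        ‖ x ‖       ≈⟨ δ≈ ⟨
        δ n         ∎
        where
        open ℤ-Solver using () renaming (solve to ℤ-solve; _:+_ to _:+ℤ_; _:=_ to _:=ℤ_; :-_ to :-ℤ_)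
        sums : + n ℤ.+ + n′ ≡ + m ℤ.+ + (suc N ℕ.∸ m)
        sums = ≡.cong +_ (≡.trans n+n′≡ (≡.sym (ℕ.m+[n∸m]≡n (ℕ.m≤n⇒m≤1+n m≤N))))
        reflected : ℤ.- (+ m ℤ.- + n) ≡ + (suc N ℕ.∸ m) ℤ.- + n′
        reflected = ≡.trans
          (ℤ-solve 3 (λ m n n′ → :-ℤ (m :+ℤ :-ℤ n) :=ℤ (n :+ℤ n′) :+ℤ (:-ℤ m :+ℤ :-ℤ n′)) ≡.refl (+ m) (+ n) (+ n′))
          (≡.trans (≡.cong (ℤ._+ (ℤ.- + m ℤ.+ ℤ.- + n′)) sums)
          (ℤ-solve 3 (λ m m′ n′ → (m :+ℤ m′) :+ℤ (:-ℤ m :+ℤ :-ℤ n′) :=ℤ m′ :+ℤ :-ℤ n′) ≡.refl (+ m) (+ (suc N ℕ.∸ m)) (+ n′)))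

      δ-reflect : ∀ {n n′} → n ℕ.< N → n′ ℕ.< N → suc n ℕ.+ n′ ≡ N → δ (suc n) ≈ δ (suc n′)
      δ-reflect {n} {n′} n<N n′<N eq = antisym
        (δ-reflect-≤ (ℕ.s≤s ℕ.z≤n) n′<N (ℕ.s≤s ℕ.z≤n) n<N (≡.trans (≡.cong suc (ℕ.+-comm n′ (suc n))) (≡.cong suc eq)))
        (δ-reflect-≤ (ℕ.s≤s ℕ.z≤n) n<N (ℕ.s≤s ℕ.z≤n) n′<N (≡.trans (ℕ.+-suc (suc n) n′) (≡.cong suc eq)))

      -- Up to negating `x` the height is `- j` with `0 ≤ j ≤ K`, and then `m = suc K - j` lies
      -- between 1 and `N`.
      δ-lower-∣∣ : ∀ {K} k {x} → K ℕ.< N → ℤ.∣ k ∣ ℕ.≤ K → (k , x) ∈ Λ → x ≉ᴹ 0ᴹ → δ (suc K) ≤ ‖ x ‖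
      δ-lower-∣∣ {K} k K<N k≤K x∈ x≉0 = go k k≤K x∈ x≉0
        where
        shift : ∀ {a b} → a ℕ.≤ b → ℤ.- (+ a) ≡ + (b ℕ.∸ a) ℤ.- + b
        shift {a} {b} a≤b = ≡.trans
          (ℤ-solve 2 (λ m a → :-ℤ a :=ℤ m :+ℤ :-ℤ (m :+ℤ a)) ≡.refl (+ (b ℕ.∸ a)) (+ a))
          (≡.cong (λ n → + (b ℕ.∸ a) ℤ.- + n) (ℕ.m∸n+n≡m a≤b))
          where open ℤ-Solver using () renaming (solve to ℤ-solve; _:+_ to _:+ℤ_; _:=_ to _:=ℤ_; :-_ to :-ℤ_)
        backwards : ∀ {j x} → j ℕ.≤ K → (ℤ.- (+ j) , x) ∈ Λ → x ≉ᴹ 0ᴹ → δ (suc K) ≤ ‖ x ‖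
        backwards {j} j≤K x∈ = δ-lower (ℕ.s≤s ℕ.z≤n) K<N (ℕ.m<n⇒0<n∸m (ℕ.s≤s j≤K))
          (ℕ.≤-trans (ℕ.m∸n≤m (suc K) j) K<N)
          (Λ-resp-≈ (shift (ℕ.m≤n⇒m≤1+n j≤K) , ≈ᴹ-refl) x∈)
        go : ∀ k {x} → ℤ.∣ k ∣ ℕ.≤ K → (k , x) ∈ Λ → x ≉ᴹ 0ᴹ → δ (suc K) ≤ ‖ x ‖
        go (ℤ.-[1+ j ]) k≤K x∈ x≉0 = backwards k≤K x∈ x≉0
        go (+ j) {x}    k≤K x∈ x≉0 = ≤-respʳ-≈ (‖‖-cong (q-neg x)) (backwards k≤K (Λ-neg (+ j) x∈) (neg-nonzero x≉0))

      -- For `n = suc K` the difference `m - n` runs from `- K` to `N - suc K`, and the second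
      -- hypothesis makes the latter at most `K`.
      δ-attained-∣∣ : ∀ {K} → K ℕ.< N → N ℕ.≤ suc (K ℕ.+ K) → ∃ λ k → ∃ λ x →
        ℤ.∣ k ∣ ℕ.≤ K × (k , x) ∈ Λ × x ≉ᴹ 0ᴹ × δ (suc K) ≈ ‖ x ‖
      δ-attained-∣∣ {K} K<N N≤ with δ-attained (ℕ.s≤s ℕ.z≤n) K<N
      ... | m , x , 1≤m , m≤N , x∈ , x≉0 , δ≈ = + m ℤ.- + suc K , x , ℕ.s≤s⁻¹ (∣difference∣< (+ m ℤ.- + suc K)
          (ℤ-solve 2 (λ m n → m :=ℤ n :+ℤ (m :+ℤ :-ℤ n)) ≡.refl (+ m) (+ suc K))
          (ℕ.≤-<-trans m≤N (ℕ.≤-<-trans N≤ (ℕ.s≤s (≡.subst (K ℕ.+ K ℕ.<_) (≡.sym (ℕ.+-suc K K)) (ℕ.n<1+n _)))))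
          (ℕ.+-monoˡ-≤ (suc K) 1≤m)) , x∈ , x≉0 , δ≈
        where open ℤ-Solver using () renaming (solve to ℤ-solve; _:+_ to _:+ℤ_; _:=_ to _:=ℤ_; :-_ to :-ℤ_)

      -- `δ (suc K)` is the minimum over `|k| ≤ K`, and `δ (suc (suc K))` that over `|k| ≤ suc K`.
      -- If they differ, the latter is attained only at `|k| = suc K`, and all lower competitors are
      -- longer.
      jump⇒record : ∀ {K} → suc K ℕ.< N → N ℕ.≤ suc (K ℕ.+ K) → δ (suc K) ≉ δ (suc (suc K)) →
                    ∃ λ x → IsRecord Λ-isSubgroup (suc K) x
      jump⇒record {K} K+1<N N≤ jump
        with δ-attained-∣∣ K<N N≤ | δ-attained-∣∣ K+1<N (ℕ.≤-trans N≤ (ℕ.s≤s (ℕ.+-mono-≤ (ℕ.n≤1+n K) (ℕ.n≤1+n K))))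
        where
        K<N : K ℕ.< N
        K<N = ℕ.<-trans (ℕ.n<1+n K) K+1<N
      ... | k₀ , x₀ , k₀≤K , x₀∈ , x₀≉0 , δ≈x₀ | k , x , k≤K+1 , x∈ , x≉0 , δ≈x = signed k x∈ ∣k∣≡K+1
        where
        K<N : K ℕ.< N
        K<N = ℕ.<-trans (ℕ.n<1+n K) K+1<N
        later≤earlier : δ (suc (suc K)) ≤ δ (suc K)
        later≤earlier = ≤-respʳ-≈ (≈-sym δ≈x₀) (δ-lower-∣∣ k₀ K+1<N (ℕ.m≤n⇒m≤1+n k₀≤K) x₀∈ x₀≉0)
        earlier≰ : ¬ δ (suc K) ≤ ‖ x ‖
        earlier≰ le = jump (antisym (≤-respʳ-≈ (≈-sym δ≈x) le) later≤earlier)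
        ∣k∣≡K+1 : ℤ.∣ k ∣ ≡ suc K
        ∣k∣≡K+1 = ℕ.≤-antisym k≤K+1 (ℕ.≰⇒> λ k≤K → earlier≰ (δ-lower-∣∣ k K<N k≤K x∈ x≉0))
        isMinimal : ∀ {x′} → q x′ ≈ q x → ∀ k {y} → (k , y) ∈ Λ → y ≉ᴹ 0ᴹ → ℤ.∣ k ∣ ℕ.< suc K → ¬ q y ≤ q x′
        isMinimal q≈ k y∈ y≉0 k<K+1 qy≤ = earlier≰
          (≤-trans (δ-lower-∣∣ k K<N (ℕ.s≤s⁻¹ k<K+1) y∈ y≉0) (‖‖-mono (≤-respʳ-≈ q≈ qy≤)))
        -- Records have natural heights, so a minimizer at height `- suc K` is negated.
        signed : ∀ k → (k , x) ∈ Λ → ℤ.∣ k ∣ ≡ suc K → ∃ λ x → IsRecord Λ-isSubgroup (suc K) x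
        signed (+ _)        x∈ ≡.refl = x , record
          { member = x∈ ; nonzero = x≉0 ; minimal = λ {k} → isMinimal ≈-refl k }
        signed (ℤ.-[1+ _ ]) x∈ ≡.refl = -ᴹ x , record
          { member = Λ-neg ℤ.-[1+ K ] x∈ ; nonzero = neg-nonzero x≉0 ; minimal = λ {k} → isMinimal (q-neg x) k }

      module _ {d} {b : Fin d → Carrierᴹ} (span : ∀ y → ∃ λ r → y ≈ᴹ linearCombination r b) (2≤N : 2 ℕ.≤ N) where
        private
          K₀ : ℕ
          K₀ = ℕ.⌊ N /2⌋

          J : ℕ
          J = N ℕ.∸ suc K₀

          K₀<N : K₀ ℕ.< N
          K₀<N = half<N 2≤N
            where
            half<N : ∀ {n} → 2 ℕ.≤ n → ℕ.⌊ n /2⌋ ℕ.< n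
            half<N {suc n} _ = ℕ.⌊n/2⌋<n n

          2K₀≤N : K₀ ℕ.+ K₀ ℕ.≤ N
          2K₀≤N = ≡.subst (K₀ ℕ.+ K₀ ℕ.≤_) (ℕ.⌊n/2⌋+⌈n/2⌉≡n N) (ℕ.+-monoʳ-≤ K₀ (ℕ.⌊n/2⌋≤⌈n/2⌉ N))

          N≤1+2K₀ : N ℕ.≤ suc (K₀ ℕ.+ K₀)
          N≤1+2K₀ = odd-or-even N
            where
            odd-or-even : ∀ n → n ℕ.≤ suc (ℕ.⌊ n /2⌋ ℕ.+ ℕ.⌊ n /2⌋)
            odd-or-even zero = ℕ.z≤n
            odd-or-even (suc zero) = ℕ.s≤s ℕ.z≤n
            odd-or-even (suc (suc n)) = ℕ.s≤s (≡.subst (suc n ℕ.≤_)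
              (≡.cong suc (≡.sym (ℕ.+-suc ℕ.⌊ n /2⌋ ℕ.⌊ n /2⌋))) (ℕ.s≤s (odd-or-even n)))

          J+K₀≡ : suc J ℕ.+ K₀ ≡ N
          J+K₀≡ = ≡.trans (≡.sym (ℕ.+-suc J K₀)) (ℕ.m∸n+n≡m K₀<N)

          -- `g 0`, ..., `g J` are the `δ n` with `K₀ < n ≤ N`; reflection supplies the smaller `n`.
          g : ℕ → Carrier
          g i = δ (suc (i ℕ.+ K₀))

          open Values ℝ
          open Jumps g

          jumpRecord : ∀ {i} → i ℕ.< J → g i ≉ g (suc i) → ∃ λ x → IsRecord Λ-isSubgroup (suc i ℕ.+ K₀) x
          jumpRecord {i} i<J = jump⇒record
            (≡.subst (suc i ℕ.+ K₀ ℕ.<_) J+K₀≡ (ℕ.s≤s (ℕ.+-monoˡ-≤ K₀ i<J)))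
            (ℕ.≤-trans N≤1+2K₀ (ℕ.s≤s (ℕ.+-mono-≤ (ℕ.m≤n+m K₀ i) (ℕ.m≤n+m K₀ i))))

          count : ∀ js → All (ℕ._< J) js → All (λ i → g i ≉ g (suc i)) js → AllPairs ℕ._>_ js → length js ℕ.≤ 2 ℕ.^ d
          count []           _ _ _ = ℕ.z≤n
          count js@(_ ∷ _) js<J js-jump js-decr = record-count Λ-isSubgroup span
            (proj₁ (proj₂ Λ-separated)) (proj₁ (proj₂ (proj₂ Λ-separated))) (proj₂ (proj₂ (proj₂ Λ-separated)))
            zero {a} (λ i → proj₂ (rec i)) injective spread largest
            where
            a : Fin (length js) → ℕ
            a i = suc (lookup js i) ℕ.+ K₀
            rec : ∀ i → ∃ λ x → IsRecord Λ-isSubgroup (a i) x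
            rec i = jumpRecord (All.lookup js<J (∈-lookup i)) (All.lookup js-jump (∈-lookup i))
            a-decreasing : ∀ {i j} → i Fin.< j → a j ℕ.< a i
            a-decreasing i<j = ℕ.s≤s (ℕ.+-monoˡ-< K₀ (AllPairs-lookup js-decr i<j))
            injective : ∀ {i j} → i ≢ j → a i ≢ a j
            injective {i} {j} i≢j eq with Fin.<-cmp i j
            ... | tri< i<j _ _ = ℕ.<⇒≢ (a-decreasing i<j) (≡.sym eq)
            ... | tri≈ _ i≡j _ = i≢j i≡j
            ... | tri> _ _ j<i = ℕ.<⇒≢ (a-decreasing j<i) eq
            -- All heights lie strictly between `K₀` and `N`, and `N ≤ 2 K₀ + 1`.
            spread : ∀ i j k → a i ℕ.< a j ℕ.+ a k
            spread i j k = ℕ.≤-<-trans (ℕ.≤-trans (ℕ.<⇒≤ (≡.subst (a i ℕ.<_) J+K₀≡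
                (ℕ.s≤s (ℕ.+-monoˡ-≤ K₀ (All.lookup js<J (∈-lookup i)))))) N≤1+2K₀)
              (ℕ.≤-<-trans (ℕ.+-monoʳ-≤ (suc K₀) (ℕ.m≤n+m K₀ (lookup js k)))
                (ℕ.+-mono-≤-< (ℕ.s≤s (ℕ.m≤n+m K₀ (lookup js j))) (ℕ.n<1+n _)))
            largest : ∀ {i} → i ≢ zero → a i ℕ.< a zero
            largest {zero}  0≢0 = contradiction ≡.refl 0≢0
            largest {suc i} _   = a-decreasing (ℕ.s≤s ℕ.z≤n)

          late-value : ∀ {n} → K₀ ℕ.≤ n → n ℕ.< N → Any (δ (suc n) ≈_) (values J)
          late-value {n} K₀≤n n<N = ≡.subst (λ m → Any (δ (suc m) ≈_) (values J)) (ℕ.m∸n+n≡m K₀≤n)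
            (all-values (ℕ.≤⇒≤′ (ℕ.∸-monoˡ-≤ (suc K₀) n<N)))

          -- For `n < K₀` the reflected index `N - suc n` is at least `N - K₀`, hence at least `K₀`.
          every-value : ∀ {n} → n ℕ.< N → Any (δ (suc n) ≈_) (values J)
          every-value {n} n<N with K₀ ℕ.≤? n
          ... | yes K₀≤n = late-value K₀≤n n<N
          ... | no  K₀≰n = Any.map (≈-trans (δ-reflect n<N n′<N (ℕ.m+[n∸m]≡n n<N)))
                             (late-value K₀≤n′ n′<N)
            where
            n′ = N ℕ.∸ suc n
            n′<N : n′ ℕ.< N
            n′<N = ℕ.∸-monoʳ-< (ℕ.s≤s ℕ.z≤n) n<N
            K₀≤n′ : K₀ ℕ.≤ n′
            K₀≤n′ = ℕ.≤-trans (ℕ.m+n≤o⇒m≤o∸n K₀ 2K₀≤N) (ℕ.∸-monoʳ-≤ N (ℕ.≰⇒> K₀≰n))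

        gap-count : #values ℝ δ N ℕ.≤ 2 ℕ.^ d ℕ.+ 1
        gap-count = ≡.subst (#values ℝ δ N ℕ.≤_) (ℕ.+-comm 1 _) (ℕ.≤-trans
          (deduplicate-length (values J) (All.map⁺ (All.map every-value (All.all-upTo N))))
          (ℕ.s≤s (≡.subst (ℕ._≤ 2 ℕ.^ d) (≡.sym (length-map (λ i → g (suc i)) (jumps J)))
            (count (jumps J) (jumps-< J) (jumps-≉ J) (jumps-decreasing J)))))

open import Data.Nat using (_+_; _^_; _≤_)

theorem1p1 : ∀ {c ℓ v ℓv p : Level} (ℝ : CompleteOrderedField c ℓ)
    (d : ℕ) → 1 ≤ d →
    (V : InnerProductSpace ℝ v ℓv) → InnerProductSpace.HasDimension V d →
    (L : Pred (InnerProductSpace.Carrierᴹ V) p) →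
    InnerProductSpace.IsFullRankLattice V L →
    (α : InnerProductSpace.Carrierᴹ V) →
    (N : ℕ) → 2 ≤ N →
    (δ : ℕ → CompleteOrderedField.Carrier ℝ) → IsMinimalDistance V L α N δ →
    #values ℝ δ N ≤ 2 ^ d + 1
theorem1p1 ℝ d 1≤d V (b , _ , span) L lattice α N 2≤N δ isMin =
  Gaps.gap-count V lattice α isMin span 2≤N
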